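{- Let $e$ be a finite set with $|e|\ge 2$, $\gamma_e:e\to\mathbb{R}_{+}$, $\gamma_e(\mathcal{S})=\sum_{v\in\mathcal{S}}\gamma_e(v)$, and let $g_e:[0,\gamma_e(e)]\to\mathbb{R}_{\ge0}$ be concave with $g_e(0)=g_e(\gamma_e(e))=0$. Let $w_e(\mathcal{S})=g_e(\gamma_e(\mathcal{S}))$ for $\mathcal{S}\subseteq e$. Define $\mathcal{Q}_a=\{\gamma_e(\mathcal{S}):\emptyset\ne\mathcal{S}\subsetneq e\}$ and $\mathcal{Q}_s=\{\gamma_e(\mathcal{S}):\mathcal{S}\subseteq e,\ 0<\gamma_e(\mathcal{S})\le\gamma_e(e)/2\}$. Then: (i) $w_e$ is graph reducible. More precisely, with $r=|\mathcal{Q}_a|$ and $b_1<\dots<b_r$ the elements of $\mathcal{Q}_a$, there exist nonnegative coefficients $a_1,\dots,a_r$ such that for all $\mathcal{S}\subseteq e$, $$w_e(\mathcal{S})=\sum_{i=1}^r a_i\min\{(\gamma_e(e)-b_i)\gamma_e(\mathcal{S}),\ b_i\gamma_e(e\setminus\mathcal{S})\},$$ so that $w_e$ is the gadget splitting function of the graph obtained as the union, over $i=1,\dots,r$, of asymmetric EDVWs-based gadgets with parameters $(a,b)=(a_i(\gamma_e(e)-b_i),\ a_ib_i)$, each with its own auxiliary vertex and all sharing the vertex set $e$ (edges of coefficient zero may be dropped). In particular $w_e$ is the gadget splitting function of a combination of at most $|\mathcal{Q}_a|$ asymmetric EDVWs-based gadgets. (ii) If in addition $g_e$ is symmetric, i.e.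 $g_e(x)=g_e(\gamma_e(e)-x)$ for all $x$, then with $r=|\mathcal{Q}_s|$ and $b_1<\dots<b_r$ the elements of $\mathcal{Q}_s$, there exist nonnegative coefficients $a_1,\dots,a_r$ such that for all $\mathcal{S}\subseteq e$, $$w_e(\mathcal{S})=\sum_{i=1}^r a_i\min\{\gamma_e(\mathcal{S}),\ \gamma_e(e\setminus\mathcal{S}),\ b_i\},$$ so that $w_e$ is the gadget splitting function of the union over $i$ of symmetric EDVWs-based gadgets with parameter $b=b_i$ and all edge weights multiplied by $a_i$, each with its own pair of auxiliary vertices and all sharing the vertex set $e$; i.e. a combination of at most $|\mathcal{Q}_s|$ symmetric EDVWs-based gadgets.
   Context: For a weighted, possibly directed graph $\mathcal{G}$ with vertex set $\mathcal{V}$ and weights $W_{uv}$ (weight of edge from $u$ to $v$), $\mathrm{cut}_{\mathcal{G}}(\mathcal{T})=\sum_{u\in\mathcal{T},v\in\mathcal{V}\setminus\mathcal{T}}W_{uv}$. A gadget for a hyperedge $e$ is a weighted, possibly directed graph $\mathcal{G}_e$ with vertex set $\mathcal{V}'=e\cup\hat{\mathcal{V}}$, $\hat{\mathcal{V}}$ a set of auxiliary vertices disjoint from $e$; its gadget splitting function is $\hat w_e(\mathcal{S})=\min_{\mathcal{T}\subseteq\mathcal{V}',\,\mathcal{T}\cap e=\mathcal{S}}\mathrm{cut}_{\mathcal{G}_e}(\mathcal{T})$. A splitting function is graph reducible if it equals some gadget splitting function. The symmetric EDVWs-based gadget with parameter $b>0$ is the directed graph on $e\cup\{e',e''\}$ with,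 for each $v\in e$, an edge $v\to e'$ of weight $\gamma_e(v)$ and an edge $e''\to v$ of weight $\gamma_e(v)$, plus an edge $e'\to e''$ of weight $b$; its gadget splitting function is $\min\{\gamma_e(\mathcal{S}),\gamma_e(e\setminus\mathcal{S}),b\}$. The asymmetric EDVWs-based gadget with parameters $a,b\ge0$ is the directed graph on $e\cup\{v_e\}$ with, for each $v\in e$, an edge $v\to v_e$ of weight $a\gamma_e(v)$ and an edge $v_e\to v$ of weight $b\gamma_e(v)$; its gadget splitting function is $\min\{a\gamma_e(\mathcal{S}),b\gamma_e(e\setminus\mathcal{S})\}$. -}

module Defs where

open import Algebra.Bundles using (CommutativeRing)
open import Algebra.Core using (Op₁; Op₂)
open import Algebra.Structures using (IsCommutativeRing)
import Algebra.Construct.NaturalChoice.Min as Min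
import Algebra.Properties.CommutativeMonoid.Sum as Sum
open import Data.Bool.Base using (Bool; not; _∧_; if_then_else_)
open import Data.Fin.Base using (Fin; zero; suc; splitAt)
import Data.Fin.Base as Fin
open import Data.Fin.Subset using (Subset; Nonempty; _⊂_; ⊤)
open import Data.List.Base using (List; foldr)
open import Data.Maybe.Base using (Maybe; just; nothing)
open import Data.Nat.Base using (ℕ)
import Data.Nat.Base as ℕ
open import Data.Product.Base using (_×_; ∃; ∃-syntax)
open import Data.Sum.Base using (_⊎_; inj₁; inj₂; [_,_]′)
open import Data.Vec.Base using (lookup)
open import Level using (Level; _⊔_) renaming (suc to lsuc)
open import Relation.Binary.Bundles using (DecTotalOrder)
open import Relation.Binary.Core using (Rel)
open import Relation.Binary.PropositionalEquality.Core using (_≡_)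
open import Relation.Binary.Structures using (IsDecTotalOrder)
import Relation.Binary.Construct.NonStrictToStrict as ToStrict
open import Relation.Nullary.Negation.Core using (¬_)
open import Relation.Unary using (Pred)

-- Totally ordered fields, with the order decidable as it is classically for ℝ.
-- The inverse is a total function whose value at 0# is unconstrained.
record OrderedField (c ℓ₁ ℓ₂ : Level) : Set (lsuc (c ⊔ ℓ₁ ⊔ ℓ₂)) where
  infix  8 -_
  infix  9 _⁻¹
  infixl 7 _*_
  infixl 6 _+_
  infix  4 _≈_ _≤_
  field
    Carrier           : Set c
    _≈_               : Rel Carrier ℓ₁
    _≤_               : Rel Carrier ℓ₂
    _+_ _*_           : Op₂ Carrier
    -_ _⁻¹            : Op₁ Carrier
    0# 1#             : Carrier
    isCommutativeRing : IsCommutativeRing _≈_ _+_ _*_ -_ 0# 1#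
    isDecTotalOrder   : IsDecTotalOrder _≈_ _≤_
    0≉1               : ¬ 0# ≈ 1#
    *-inverseʳ        : ∀ {x} → ¬ x ≈ 0# → x * x ⁻¹ ≈ 1#
    +-monoʳ-≤         : ∀ x {y z} → y ≤ z → x + y ≤ x + z
    *-nonNegative     : ∀ {x y} → 0# ≤ x → 0# ≤ y → 0# ≤ x * y

  commutativeRing : CommutativeRing c ℓ₁
  commutativeRing = record { isCommutativeRing = isCommutativeRing }

  decTotalOrder : DecTotalOrder c ℓ₁ ℓ₂
  decTotalOrder = record { isDecTotalOrder = isDecTotalOrder }

  open CommutativeRing commutativeRing public using (_-_; +-commutativeMonoid)
  open DecTotalOrder decTotalOrder public using (_≟_; _≤?_; totalOrder)
  open ToStrict _≈_ _≤_ public using (_<_)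
  open Min totalOrder public using (_⊓_)
  open Sum +-commutativeMonoid public using (sum; sum-syntax)

module EDVW {c ℓ₁ ℓ₂} (K : OrderedField c ℓ₁ ℓ₂) where
  open OrderedField K

  ----------------------------------------------------------------------
  -- Functions on an interval [0, M]: a total function on the carrier of
  -- which only the values on [0, M] are ever constrained.

  _∈[0,_] : Carrier → Carrier → Set ℓ₂
  x ∈[0, M ] = 0# ≤ x × x ≤ M

  -- Carrier is a setoid, so a function of field elements has to respect _≈_.
  CongruentOn : Carrier → (Carrier → Carrier) → Set (c ⊔ ℓ₁ ⊔ ℓ₂)
  CongruentOn M g = ∀ {x y} → x ∈[0, M ] → y ∈[0, M ] → x ≈ y → g x ≈ g y

  NonNegativeOn : Carrier → (Carrier → Carrier) → Set (c ⊔ ℓ₂)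
  NonNegativeOn M g = ∀ {x} → x ∈[0, M ] → 0# ≤ g x

  ConcaveOn : Carrier → (Carrier → Carrier) → Set (c ⊔ ℓ₂)
  ConcaveOn M g = ∀ {x y t} → x ∈[0, M ] → y ∈[0, M ] → t ∈[0, 1# ] →
    t * g x + (1# - t) * g y ≤ g (t * x + (1# - t) * y)

  SymmetricOn : Carrier → (Carrier → Carrier) → Set (c ⊔ ℓ₁ ⊔ ℓ₂)
  SymmetricOn M g = ∀ {x} → x ∈[0, M ] → g x ≈ g (M - x)

  ----------------------------------------------------------------------
  -- The hyperedge e is Fin n.

  ⟦_⟧ : ∀ {n} → (Fin n → Carrier) → Subset n → Carrier
  ⟦ γ ⟧ S = sum (λ v → if lookup S v then γ v else 0#)

  Qₐ : ∀ {n} → (Fin n → Carrier) → Pred Carrier ℓ₁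
  Qₐ γ x = ∃[ S ] Nonempty S × S ⊂ ⊤ × x ≈ ⟦ γ ⟧ S

  Qₛ : ∀ {n} → (Fin n → Carrier) → Pred Carrier (ℓ₁ ⊔ ℓ₂)
  Qₛ γ x = ∃[ S ] 0# < ⟦ γ ⟧ S × ⟦ γ ⟧ S ≤ ⟦ γ ⟧ ⊤ * (1# + 1#) ⁻¹ × x ≈ ⟦ γ ⟧ S

  -- b lists the elements of Q in strictly increasing order; hence r = |Q|, and
  -- r and b are determined by Q (b up to _≈_).
  record IncreasinglyEnumerates {q} (Q : Pred Carrier q) {r} (b : Fin r → Carrier)
      : Set (c ⊔ q ⊔ ℓ₁ ⊔ ℓ₂) where
    field
      increasing : ∀ {i j} → i Fin.< j → b i < b j
      sound      : ∀ i → Q (b i)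
      complete   : ∀ {x} → Q x → ∃[ i ] x ≈ b i

  ----------------------------------------------------------------------
  -- Gadgets: directed graphs given by a weight matrix, a missing edge being
  -- one of weight 0#.

  Vertex : ℕ → ℕ → Set
  Vertex n m = Fin n ⊎ Fin m

  record Gadget (n : ℕ) : Set c where
    field
      #aux   : ℕ
      weight : Vertex n #aux → Vertex n #aux → Carrier
  open Gadget public

  NonNegativeWeights : ∀ {n} → Gadget n → Set ℓ₂
  NonNegativeWeights G = ∀ u v → 0# ≤ weight G u v

  VertexSet : ℕ → ℕ → Set
  VertexSet n m = Vertex n m → Bool

  sumᵛ : ∀ {n m} → (Vertex n m → Carrier) → Carrier
  sumᵛ f = sum (λ v → f (inj₁ v)) + sum (λ v → f (inj₂ v))

  cut : ∀ {n} (G : Gadget n) → VertexSet n (#aux G) → Carrier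
  cut G T = sumᵛ (λ u → sumᵛ (λ v → if T u ∧ not (T v) then weight G u v else 0#))

  -- T ∩ e = S
  _∩e≡_ : ∀ {n m} → VertexSet n m → Subset n → Set
  T ∩e≡ S = ∀ v → T (inj₁ v) ≡ lookup S v

  -- w S is, for every S, the minimum of cut G T over all T with T ∩ e = S.
  IsGadgetSplittingFunction : ∀ {n} → Gadget n → (Subset n → Carrier) → Set (ℓ₁ ⊔ ℓ₂)
  IsGadgetSplittingFunction G w = ∀ S →
    (∃[ T ] T ∩e≡ S × cut G T ≈ w S) × (∀ T → T ∩e≡ S → w S ≤ cut G T)

  GraphReducible : ∀ {n} → (Subset n → Carrier) → Set (c ⊔ ℓ₁ ⊔ ℓ₂)
  GraphReducible {n} w =
    ∃ λ (G : Gadget n) → NonNegativeWeights G × IsGadgetSplittingFunction G w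

  scale : ∀ {n} → Carrier → Gadget n → Gadget n
  scale a G = record { #aux = #aux G ; weight = λ u v → a * weight G u v }

  asymmetricGadget : ∀ {n} → (Fin n → Carrier) → (a b : Carrier) → Gadget n
  asymmetricGadget {n} γ a b = record { #aux = 1 ; weight = W }
    where
    W : Vertex n 1 → Vertex n 1 → Carrier
    W (inj₁ v) (inj₂ _) = a * γ v
    W (inj₂ _) (inj₁ v) = b * γ v
    W (inj₁ _) (inj₁ _) = 0#
    W (inj₂ _) (inj₂ _) = 0#

  symmetricGadget : ∀ {n} → (Fin n → Carrier) → (b : Carrier) → Gadget n
  symmetricGadget {n} γ b = record { #aux = 2 ; weight = W }
    where
    pattern e′ = inj₂ zero
    pattern e″ = inj₂ (suc zero)
    W : Vertex n 2 → Vertex n 2 → Carrier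
    W (inj₁ v) e′       = γ v
    W e″       (inj₁ v) = γ v
    W e′       e″       = b
    W (inj₁ _) (inj₁ _) = 0#
    W (inj₁ _) e″       = 0#
    W e′       (inj₁ _) = 0#
    W e′       e′       = 0#
    W e″       e′       = 0#
    W e″       e″       = 0#

  leftPart : ∀ {n} m {k} → Vertex n (m ℕ.+ k) → Maybe (Vertex n m)
  leftPart m (inj₁ v) = just (inj₁ v)
  leftPart m (inj₂ x) = [ (λ i → just (inj₂ i)) , (λ _ → nothing) ]′ (splitAt m x)

  rightPart : ∀ {n} m {k} → Vertex n (m ℕ.+ k) → Maybe (Vertex n k)
  rightPart m (inj₁ v) = just (inj₁ v)
  rightPart m (inj₂ x) = [ (λ _ → nothing) , (λ j → just (inj₂ j)) ]′ (splitAt m x)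

  weight? : ∀ {n} (G : Gadget n) (u v : Maybe (Vertex n (#aux G))) → Carrier
  weight? G (just u) (just v) = weight G u v
  weight? G (just _) nothing  = 0#
  weight? G nothing  _        = 0#

  -- Union of two gadgets sharing exactly the vertices of e; parallel edges add up.
  _∪_ : ∀ {n} → Gadget n → Gadget n → Gadget n
  G ∪ H = record
    { #aux   = #aux G ℕ.+ #aux H
    ; weight = λ u v → weight? G (leftPart (#aux G) u) (leftPart (#aux G) v)
                     + weight? H (rightPart (#aux G) u) (rightPart (#aux G) v)
    }

  edgeless : ∀ {n} → Gadget n
  edgeless = record { #aux = 0 ; weight = λ _ _ → 0# }

  ⋃ : ∀ {n} → List (Gadget n) → Gadget n
  ⋃ = foldr _∪_ edgeless

  IsAsymmetricGadget : ∀ {n} → (Fin n → Carrier) → Gadget n → Set (c ⊔ ℓ₂)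
  IsAsymmetricGadget γ G =
    ∃[ a ] ∃[ b ] 0# ≤ a × 0# ≤ b × G ≡ asymmetricGadget γ a b

  IsScaledSymmetricGadget : ∀ {n} → (Fin n → Carrier) → Gadget n → Set (c ⊔ ℓ₁ ⊔ ℓ₂)
  IsScaledSymmetricGadget γ G =
    ∃[ a ] ∃[ b ] 0# ≤ a × 0# < b × G ≡ scale a (symmetricGadget γ b)

module Submission where

open import Defs
open import Algebra.Bundles using (CommutativeRing)
import Algebra.Construct.NaturalChoice.Min as Min
import Algebra.Properties.AbelianGroup as AbelianGroupProperties
import Algebra.Properties.Ring as RingProperties
import Algebra.Properties.Semiring.Mult as Mult
import Algebra.Properties.Semiring.Sum as Sum
import Algebra.Solver.Ring as RingSolver
open import Algebra.Solver.Ring.AlmostCommutativeRing using (fromCommutativeRing; _-Raw-AlmostCommutative⟶_)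
open import Data.Bool.Base using (Bool; true; false; not; _∧_; if_then_else_)
open import Data.Bool.Properties using (∧-zeroʳ; ∧-identityʳ)
open import Data.Fin.Base using (Fin; zero; suc; fromℕ; _↑ˡ_; _↑ʳ_; splitAt)
import Data.Fin.Base as Fin
import Data.Fin.Properties as Fin
open import Data.Fin.Properties using (splitAt-↑ˡ; splitAt-↑ʳ)
open import Data.Fin.Subset using (Subset; inside; outside; Nonempty; _⊂_; ⊤; ∁)
open import Data.Fin.Subset.Properties using (nonempty?; _⊂?_; ⊆⊤; ∈⊤; x∈∁p⇒x∉p; x∉p⇒x∈∁p)
open import Data.Integer.Base using (ℤ; +_; -[1+_]; _⊖_)
import Data.Integer.Base as ℤ
import Data.Integer.Properties as ℤ
open import Data.List.Base using (List; []; _∷_; _++_; length; map; filter; foldr; allFin; tabulate)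
import Data.List.Base as List
import Data.List.Properties as List
open import Data.List.Membership.Propositional using (_∈_)
open import Data.List.Membership.Propositional.Properties using (∈-map⁺; ∈-++⁺ˡ; ∈-++⁺ʳ; ∈-filter⁺; ∈-lookup)
open import Data.List.Relation.Unary.All using (All; []; _∷_)
import Data.List.Relation.Unary.All as All
import Data.List.Relation.Unary.All.Properties as All
open import Data.List.Relation.Unary.AllPairs using (AllPairs; []; _∷_)
open import Data.List.Relation.Unary.Any using (Any; here; there)
import Data.List.Relation.Unary.Any as Any
import Data.List.Relation.Unary.Any.Properties as Any
open import Data.Maybe.Base using (just; nothing)
import Data.Maybe.Base as Maybe
open import Data.Nat.Base using (ℕ; zero; suc)
import Data.Nat.Base as ℕ
import Data.Nat.Properties as ℕ
open import Data.Product.Base using (_×_; _,_; proj₁; proj₂; ∃; ∃-syntax)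
open import Data.Sum.Base using (_⊎_; inj₁; inj₂; [_,_]′)
open import Data.Vec.Base using ([]; _∷_; lookup)
open import Data.Vec.Properties using (lookup-map; lookup-replicate; []=⇒lookup; lookup⇒[]=)
open import Function.Base using (_∘_; id)
open import Level using (_⊔_)
open import Relation.Binary.Bundles using (DecTotalOrder; StrictTotalOrder)
import Relation.Binary.Construct.NonStrictToStrict as ToStrict
open import Relation.Binary.Definitions using (tri<; tri≈; tri>)
open import Relation.Binary.PropositionalEquality.Core as ≡ using (_≡_)
import Relation.Binary.Reasoning.PartialOrder as PartialOrderReasoning
import Relation.Binary.Reasoning.Setoid as SetoidReasoning
open import Relation.Nullary.Decidable.Core using (yes; no; ¬?; _×-dec_; dec⇒maybe; decidable-stable)
open import Relation.Nullary.Negation.Core using (¬_; contradiction)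
open import Relation.Unary using (Pred; Decidable)

-- Through the breakpoints 0 < b₁ < … < bᵣ a concave function that vanishes at 0
-- and is nondecreasing interpolates as Σ cᵢ min(x , bᵢ), where cᵢ ≥ 0 is the drop
-- of slope at bᵢ.  In the symmetric case g is nondecreasing up to M/2, and this
-- expansion at x = min(γ(S) , γ(e∖S)) is already the claim.  In general, add to g
-- the linear function k x that makes it flat from bᵣ to M; evaluating the
-- expansion at M gives k M = Σ cᵢ bᵢ, so that
--   g(x) = Σ cᵢ (min(x , bᵢ) − bᵢ x / M) = Σ (cᵢ / M) min((M − bᵢ) x , bᵢ (M − x)).
-- Splitting functions of gadgets that share only e add up under union, since the
-- auxiliary vertices of each gadget can be placed independently.

-- Falling slopes make every coefficient nonnegative except the last. Beyond bᵣ the sum Σ cᵢ min(x ,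
-- bᵢ) is constant, so cᵣ is the slope on the last segment minus 0, and that slope has to be
-- nonnegative as well. This is the obstacle: g must come back down to 0 at M and may already fall
-- before bᵣ. A linear term leaves all slope drops unchanged, so it can be chosen freely; k = g(bᵣ)
-- / (M - bᵣ) gives g(x) + k x the same value at bᵣ and at M, and a concave function whose final
-- piece is flat is nondecreasing before it. The expansion is wanted only at weights of subsets. In
-- (i) these are the breakpoints together with 0 and M; in (ii) the lighter of S and e∖S weighs 0 or
-- is a breakpoint. The breakpoints are removed from the left, since the sum of the remaining
-- coefficients is then the slope of the next segment. A new coefficient is nonnegative by one
-- comparison of adjacent slopes, made with denominators multiplied out.

module IntegerCoefficients {c ℓ} (R : CommutativeRing c ℓ) where
  open CommutativeRing R
  open AbelianGroupProperties +-abelianGroup using (⁻¹-∙-comm; ⁻¹-involutive; ε⁻¹≈ε)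
  open RingProperties ring using (-‿distribˡ-*; -‿distribʳ-*)
  open Mult semiring using (×-homo-+; ×1-homo-*) renaming (_×_ to _·_)
  open SetoidReasoning setoid

  ⟦_⟧ℤ : ℤ → Carrier
  ⟦ + n ⟧ℤ      = n · 1#
  ⟦ -[1+ n ] ⟧ℤ = - (suc n · 1#)

  ⟦⊖⟧ : ∀ m n → ⟦ m ⊖ n ⟧ℤ ≈ m · 1# - n · 1#
  ⟦⊖⟧ m       zero    = sym (trans (+-congˡ ε⁻¹≈ε) (+-identityʳ _))
  ⟦⊖⟧ zero    (suc n) = sym (+-identityˡ _)
  ⟦⊖⟧ (suc m) (suc n) = begin
    ⟦ suc m ⊖ suc n ⟧ℤ                    ≡⟨ ≡.cong ⟦_⟧ℤ (ℤ.[1+m]⊖[1+n]≡m⊖n m n) ⟩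
    ⟦ m ⊖ n ⟧ℤ                            ≈⟨ ⟦⊖⟧ m n ⟩
    m · 1# - n · 1#                       ≈⟨ +-congʳ (+-identityˡ _) ⟨
    0# + m · 1# - n · 1#                  ≈⟨ +-congʳ (+-congʳ (-‿inverseʳ 1#)) ⟨
    1# - 1# + m · 1# - n · 1#             ≈⟨ +-congʳ (+-assoc _ _ _) ⟩
    1# + (- 1# + m · 1#) - n · 1#         ≈⟨ +-congʳ (+-congˡ (+-comm _ _)) ⟩
    1# + (m · 1# - 1#) - n · 1#           ≈⟨ +-congʳ (+-assoc _ _ _) ⟨
    1# + m · 1# - 1# - n · 1#             ≈⟨ +-assoc _ _ _ ⟩
    1# + m · 1# + (- 1# - n · 1#)         ≈⟨ +-congˡ (⁻¹-∙-comm _ _) ⟩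
    suc m · 1# - suc n · 1#               ∎

  +-homo : ∀ i j → ⟦ i ℤ.+ j ⟧ℤ ≈ ⟦ i ⟧ℤ + ⟦ j ⟧ℤ
  +-homo (+ m)      (+ n)      = ×-homo-+ 1# m n
  +-homo (+ m)      -[1+ n ]   = ⟦⊖⟧ m (suc n)
  +-homo -[1+ m ]   (+ n)      = trans (⟦⊖⟧ n (suc m)) (+-comm _ _)
  +-homo -[1+ m ]   -[1+ n ]   = begin
    - (suc (suc (m ℕ.+ n)) · 1#)         ≡⟨ ≡.cong (λ k → - (k · 1#)) (≡.cong suc (≡.sym (ℕ.+-suc m n))) ⟩
    - ((suc m ℕ.+ suc n) · 1#)           ≈⟨ -‿cong (×-homo-+ 1# (suc m) (suc n)) ⟩
    - (suc m · 1# + suc n · 1#)          ≈⟨ ⁻¹-∙-comm _ _ ⟨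
    - (suc m · 1#) - suc n · 1#          ∎

  -‿homo : ∀ i → ⟦ ℤ.- i ⟧ℤ ≈ - ⟦ i ⟧ℤ
  -‿homo (+ zero)   = sym ε⁻¹≈ε
  -‿homo (+ suc n)  = refl
  -‿homo -[1+ n ]   = sym (⁻¹-involutive _)

  *-homo⁺ : ∀ m n → ⟦ + m ℤ.* + n ⟧ℤ ≈ m · 1# * n · 1#
  *-homo⁺ m n = trans (reflexive (≡.cong ⟦_⟧ℤ (≡.sym (ℤ.pos-* m n)))) (×1-homo-* m n)

  *-homo⁺ʳ : ∀ i n → ⟦ i ℤ.* + n ⟧ℤ ≈ ⟦ i ⟧ℤ * n · 1#
  *-homo⁺ʳ (+ m)    n = *-homo⁺ m n
  *-homo⁺ʳ -[1+ m ] n = begin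
    ⟦ ℤ.- (+ suc m) ℤ.* + n ⟧ℤ     ≡⟨ ≡.cong ⟦_⟧ℤ (≡.sym (ℤ.neg-distribˡ-* (+ suc m) (+ n))) ⟩
    ⟦ ℤ.- (+ suc m ℤ.* + n) ⟧ℤ     ≈⟨ -‿homo (+ suc m ℤ.* + n) ⟩
    - ⟦ + suc m ℤ.* + n ⟧ℤ         ≈⟨ -‿cong (*-homo⁺ (suc m) n) ⟩
    - (suc m · 1# * n · 1#)        ≈⟨ -‿distribˡ-* _ _ ⟩
    - (suc m · 1#) * n · 1#        ∎

  *-homo : ∀ i j → ⟦ i ℤ.* j ⟧ℤ ≈ ⟦ i ⟧ℤ * ⟦ j ⟧ℤ
  *-homo i (+ n)    = *-homo⁺ʳ i n
  *-homo i -[1+ n ] = begin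
    ⟦ i ℤ.* ℤ.- (+ suc n) ⟧ℤ       ≡⟨ ≡.cong ⟦_⟧ℤ (≡.sym (ℤ.neg-distribʳ-* i (+ suc n))) ⟩
    ⟦ ℤ.- (i ℤ.* + suc n) ⟧ℤ       ≈⟨ -‿homo (i ℤ.* + suc n) ⟩
    - ⟦ i ℤ.* + suc n ⟧ℤ           ≈⟨ -‿cong (*-homo⁺ʳ i (suc n)) ⟩
    - (⟦ i ⟧ℤ * suc n · 1#)        ≈⟨ -‿distribʳ-* _ _ ⟩
    ⟦ i ⟧ℤ * - (suc n · 1#)        ∎

  morphism : ℤ.+-*-rawRing -Raw-AlmostCommutative⟶ fromCommutativeRing R
  morphism = record
    { ⟦_⟧    = ⟦_⟧ℤ
    ; +-homo = +-homo
    ; *-homo = *-homo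
    ; -‿homo = -‿homo
    ; 0-homo = refl
    ; 1-homo = +-identityʳ 1#
    }

  -- Coefficients are integers because their equality evaluates, while closed terms over an abstract
  -- ring are stuck. `con (+ 0)` denotes `0#` definitionally, but `con (+ 1)` denotes `1# + 0#`;
  -- hence `1#` enters the identities below as a variable.
  module Solver = RingSolver ℤ.+-*-rawRing (fromCommutativeRing R) morphism
    (λ i j → Maybe.map (λ i≡j → reflexive (≡.cong ⟦_⟧ℤ i≡j)) (dec⇒maybe (i ℤ.≟ j)))

subsets : ∀ n → List (Subset n)
subsets zero    = [] ∷ []
subsets (suc n) = map (inside ∷_) (subsets n) ++ map (outside ∷_) (subsets n)

∈-subsets : ∀ {n} (S : Subset n) → S ∈ subsets n
∈-subsets []            = here ≡.refl
∈-subsets (inside ∷ S)  = ∈-++⁺ˡ (∈-map⁺ (inside ∷_) (∈-subsets S))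
∈-subsets {suc n} (outside ∷ S) = ∈-++⁺ʳ (map (inside ∷_) (subsets n)) (∈-map⁺ (outside ∷_) (∈-subsets S))

module EDVWProperties {c ℓ₁ ℓ₂} (K : OrderedField c ℓ₁ ℓ₂) where
  open OrderedField K
  open EDVW K
  open CommutativeRing commutativeRing
    using ( refl; sym; trans; reflexive; semiring
          ; +-cong; +-congˡ; +-congʳ; +-assoc; +-comm; +-identityˡ; +-identityʳ
          ; *-congˡ; *-congʳ; *-assoc; *-identityˡ; *-identityʳ
          ; zeroˡ; zeroʳ; distribˡ; -‿cong; -‿inverseʳ )
  open DecTotalOrder decTotalOrder
    using (poset; total; antisym; ≤-respˡ-≈; ≤-respʳ-≈)
    renaming (refl to ≤-refl; reflexive to ≤-reflexive; trans to ≤-trans)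
  open IntegerCoefficients.Solver commutativeRing
    using (solve; _:+_; _:*_; _:-_; :-_; _:=_; con)
  open Min totalOrder
    using ( ⊓-cong; ⊓-congʳ; ⊓-idem; ⊓-sel; x⊓y≤x; x⊓y≤y; x≤y⇒x⊓y≈x; x≤y⇒y⊓x≈x; mono-≤-distrib-⊓ )
  open Sum semiring
    using (sum-cong-≋; ∑-distrib-+; sum-replicate-zero; *-distribˡ-sum; *-distribʳ-sum)
  open PartialOrderReasoning poset

  -- Ordered-field arithmetic and chord inequalities

  +-mono-≤ : ∀ {x y u v} → x ≤ y → u ≤ v → x + u ≤ y + v
  +-mono-≤ {x} {y} {u} {v} x≤y u≤v = begin
    x + u  ≤⟨ +-monoʳ-≤ x u≤v ⟩
    x + v  ≈⟨ +-comm x v ⟩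
    v + x  ≤⟨ +-monoʳ-≤ v x≤y ⟩
    v + y  ≈⟨ +-comm v y ⟩
    y + v  ∎

  +-nonNegative : ∀ {x y} → 0# ≤ x → 0# ≤ y → 0# ≤ x + y
  +-nonNegative 0≤x 0≤y = ≤-respˡ-≈ (+-identityˡ 0#) (+-mono-≤ 0≤x 0≤y)

  x≤y⇒0≤y-x : ∀ {x y} → x ≤ y → 0# ≤ y - x
  x≤y⇒0≤y-x {x} {y} x≤y = begin
    0#     ≈⟨ -‿inverseʳ x ⟨
    x - x  ≤⟨ +-mono-≤ x≤y ≤-refl ⟩
    y - x  ∎

  0≤y-x⇒x≤y : ∀ {x y} → 0# ≤ y - x → x ≤ y
  0≤y-x⇒x≤y {x} {y} 0≤y-x = begin
    x            ≈⟨ +-identityʳ x ⟨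
    x + 0#       ≤⟨ +-monoʳ-≤ x 0≤y-x ⟩
    x + (y - x)  ≈⟨ solve 2 (λ x y → x :+ (y :- x) := y) refl x y ⟩
    y            ∎

  x-y≈0⇒x≈y : ∀ {x y} → x - y ≈ 0# → x ≈ y
  x-y≈0⇒x≈y {x} {y} x-y≈0 = begin-equality
    x            ≈⟨ solve 2 (λ x y → x := y :+ (x :- y)) refl x y ⟩
    y + (x - y)  ≈⟨ +-congˡ x-y≈0 ⟩
    y + 0#       ≈⟨ +-identityʳ y ⟩
    y            ∎

  x<y⇒0<y-x : ∀ {x y} → x < y → 0# < y - x
  x<y⇒0<y-x (x≤y , x≉y) =
    x≤y⇒0≤y-x x≤y , λ 0≈y-x → x≉y (sym (x-y≈0⇒x≈y (sym 0≈y-x)))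

  *-monoˡ-≤ : ∀ {x y z} → 0# ≤ x → y ≤ z → x * y ≤ x * z
  *-monoˡ-≤ {x} {y} {z} 0≤x y≤z = 0≤y-x⇒x≤y (begin
    0#             ≤⟨ *-nonNegative 0≤x (x≤y⇒0≤y-x y≤z) ⟩
    x * (z - y)    ≈⟨ solve 3 (λ x y z → x :* (z :- y) := x :* z :- x :* y) refl x y z ⟩
    x * z - x * y  ∎)

  -- If 1 were at most 0, then 0 - 1 would be nonnegative, and 1 is its square.
  0≤1 : 0# ≤ 1#
  0≤1 with total 0# 1#
  ... | inj₁ 0≤1 = 0≤1
  ... | inj₂ 1≤0 = begin
    0#                     ≤⟨ *-nonNegative (x≤y⇒0≤y-x 1≤0) (x≤y⇒0≤y-x 1≤0) ⟩
    (0# - 1#) * (0# - 1#)  ≈⟨ solve 1 (λ x → (con (+ 0) :- x) :* (con (+ 0) :- x) := x :* x) refl 1# ⟩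
    1# * 1#                ≈⟨ *-identityʳ 1# ⟩
    1#                     ∎

  0<x⇒x*x⁻¹≈1 : ∀ {x} → 0# < x → x * x ⁻¹ ≈ 1#
  0<x⇒x*x⁻¹≈1 (_ , 0≉x) = *-inverseʳ (λ x≈0 → 0≉x (sym x≈0))

  ⁻¹-nonNegative : ∀ {x} → 0# < x → 0# ≤ x ⁻¹
  ⁻¹-nonNegative {x} 0<x with total 0# (x ⁻¹)
  ... | inj₁ 0≤x⁻¹ = 0≤x⁻¹
  ... | inj₂ x⁻¹≤0 = contradiction (antisym 0≤1 1≤0) 0≉1
    where
    1≤0 : 1# ≤ 0#
    1≤0 = begin
      1#        ≈⟨ 0<x⇒x*x⁻¹≈1 0<x ⟨
      x * x ⁻¹  ≤⟨ *-monoˡ-≤ (proj₁ 0<x) x⁻¹≤0 ⟩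
      x * 0#    ≈⟨ zeroʳ x ⟩
      0#        ∎

  x⁻¹*[x*y]≈y : ∀ {x} y → 0# < x → x ⁻¹ * (x * y) ≈ y
  x⁻¹*[x*y]≈y {x} y 0<x = begin-equality
    x ⁻¹ * (x * y)  ≈⟨ solve 3 (λ x i y → i :* (x :* y) := x :* i :* y) refl x (x ⁻¹) y ⟩
    x * x ⁻¹ * y    ≈⟨ *-congʳ (0<x⇒x*x⁻¹≈1 0<x) ⟩
    1# * y          ≈⟨ *-identityˡ y ⟩
    y               ∎

  *-cancelˡ-≤ : ∀ {x y z} → 0# < x → x * y ≤ x * z → y ≤ z
  *-cancelˡ-≤ {x} {y} {z} 0<x xy≤xz = begin
    y               ≈⟨ x⁻¹*[x*y]≈y y 0<x ⟨
    x ⁻¹ * (x * y)  ≤⟨ *-monoˡ-≤ (⁻¹-nonNegative 0<x) xy≤xz ⟩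
    x ⁻¹ * (x * z)  ≈⟨ x⁻¹*[x*y]≈y z 0<x ⟩
    z               ∎

  x*[y*x⁻¹]≈y : ∀ {x} y → 0# < x → x * (y * x ⁻¹) ≈ y
  x*[y*x⁻¹]≈y {x} y 0<x = begin-equality
    x * (y * x ⁻¹)  ≈⟨ solve 3 (λ x i y → x :* (y :* i) := i :* (x :* y)) refl x (x ⁻¹) y ⟩
    x ⁻¹ * (x * y)  ≈⟨ x⁻¹*[x*y]≈y y 0<x ⟩
    y               ∎

  -- The chord inequality with denominators cleared.
  AboveChord : (Carrier → Carrier) → Carrier → Carrier → Carrier → Set ℓ₂
  AboveChord f x y z = (z - y) * f x + (y - x) * f z ≤ (z - x) * f y

  -- Concavity with weight t = (z - y) / (z - x), for which t x + (1 - t) z is y, multiplied through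
  -- by z - x. The mean is only `≈` to y, so congruence carries f across.
  concave⇒aboveChord : ∀ {M f x y z} → CongruentOn M f → ConcaveOn M f →
    x ∈[0, M ] → z ∈[0, M ] → x ≤ y → y ≤ z → x < z → AboveChord f x y z
  concave⇒aboveChord {M} {f} {x} {y} {z} f-cong f-concave x∈ z∈ x≤y y≤z x<z = begin
    (z - y) * f x + (y - x) * f z
      ≈⟨ +-cong (*-congʳ (x*[y*x⁻¹]≈y (z - y) 0<d)) (*-congʳ d-dt≈y-x) ⟨
    d * t * f x + (d - d * t) * f z
      -- The solver sees `1#` as a variable, so `d` is first written as `d * 1#`.
      ≈⟨ +-congˡ (*-congʳ (+-congʳ (*-identityʳ d))) ⟨
    d * t * f x + (d * 1# - d * t) * f z
      ≈⟨ solve 5 (λ d t o u v → d :* t :* u :+ (d :* o :- d :* t) :* v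
                              := d :* (t :* u :+ (o :- t) :* v)) refl d t 1# (f x) (f z) ⟩
    d * (t * f x + (1# - t) * f z)
      ≤⟨ *-monoˡ-≤ (proj₁ 0<d) (f-concave x∈ z∈ (0≤t , t≤1)) ⟩
    d * f (t * x + (1# - t) * z)
      ≈⟨ *-congˡ (f-cong (≤-respʳ-≈ (sym mean≈y) (proj₁ y∈) , ≤-respˡ-≈ (sym mean≈y) (proj₂ y∈)) y∈ mean≈y) ⟩
    d * f y ∎
    where
    d t : Carrier
    d = z - x
    t = (z - y) * d ⁻¹
    0<d : 0# < d
    0<d = x<y⇒0<y-x x<z
    0≤t : 0# ≤ t
    0≤t = *-nonNegative (x≤y⇒0≤y-x y≤z) (⁻¹-nonNegative 0<d)
    y∈ : y ∈[0, M ]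
    y∈ = ≤-trans (proj₁ x∈) x≤y , ≤-trans y≤z (proj₂ z∈)
    d-dt≈y-x : d - d * t ≈ y - x
    d-dt≈y-x = begin-equality
      d - d * t          ≈⟨ +-congˡ (-‿cong (x*[y*x⁻¹]≈y (z - y) 0<d)) ⟩
      z - x - (z - y)    ≈⟨ solve 3 (λ x y z → z :- x :- (z :- y) := y :- x) refl x y z ⟩
      y - x              ∎
    t≤1 : t ≤ 1#
    t≤1 = *-cancelˡ-≤ 0<d (begin
      d * t       ≤⟨ 0≤y-x⇒x≤y (≤-respʳ-≈ (sym d-dt≈y-x) (x≤y⇒0≤y-x x≤y)) ⟩
      d           ≈⟨ *-identityʳ d ⟨
      d * 1#      ∎)
    mean≈y : t * x + (1# - t) * z ≈ y
    mean≈y = begin-equality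
      t * x + (1# - t) * z   ≈⟨ solve 4 (λ t x z o → t :* x :+ (o :- t) :* z := o :* z :- (z :- x) :* t) refl t x z 1# ⟩
      1# * z - d * t         ≈⟨ +-cong (*-identityˡ z) (-‿cong (x*[y*x⁻¹]≈y (z - y) 0<d)) ⟩
      z - (z - y)            ≈⟨ solve 2 (λ y z → z :- (z :- y) := y) refl y z ⟩
      y                      ∎

  -- A linear function coincides with its chords, so both sides grow by the same amount (z - x) k y.
  aboveChord-addLinear : ∀ {f x y z} k → AboveChord f x y z → AboveChord (λ u → f u + k * u) x y z
  aboveChord-addLinear {f} {x} {y} {z} k above = begin
    (z - y) * (f x + k * x) + (y - x) * (f z + k * z)
      ≈⟨ solve 6 (λ x y z k u v → (z :- y) :* (u :+ k :* x) :+ (y :- x) :* (v :+ k :* z)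
                                := (z :- y) :* u :+ (y :- x) :* v :+ (z :- x) :* (k :* y))
           refl x y z k (f x) (f z) ⟩
    (z - y) * f x + (y - x) * f z + (z - x) * (k * y)
      ≤⟨ +-mono-≤ above ≤-refl ⟩
    (z - x) * f y + (z - x) * (k * y)
      ≈⟨ distribˡ (z - x) (f y) (k * y) ⟨
    (z - x) * (f y + k * y) ∎

  -- Slopes fall from left to right: a nonnegative slope on [y , z] forces one on [x , y].
  aboveChord⇒≤ : ∀ {f x y z} → AboveChord f x y z → x ≤ y → y < z → f y ≤ f z → f x ≤ f y
  aboveChord⇒≤ {f} {x} {y} {z} above x≤y y<z fy≤fz = *-cancelˡ-≤ (x<y⇒0<y-x y<z) (begin
    (z - y) * f x
      ≈⟨ solve 5 (λ x y z u v → (z :- y) :* u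
                              := (z :- y) :* u :+ (y :- x) :* v :+ :- ((y :- x) :* v))
           refl x y z (f x) (f z) ⟩
    (z - y) * f x + (y - x) * f z + - ((y - x) * f z)
      ≤⟨ +-mono-≤ above ≤-refl ⟩
    (z - x) * f y - (y - x) * f z
      ≈⟨ solve 5 (λ x y z u v → (z :- x) :* u :- (y :- x) :* v
                              := (z :- y) :* u :- (y :- x) :* (v :- u))
           refl x y z (f y) (f z) ⟩
    (z - y) * f y - (y - x) * (f z - f y)
      ≤⟨ 0≤y-x⇒x≤y (≤-respʳ-≈ (solve 2 (λ a b → b := a :- (a :- b)) refl _ _)
           (*-nonNegative (x≤y⇒0≤y-x x≤y) (x≤y⇒0≤y-x fy≤fz))) ⟩
    (z - y) * f y ∎)

  -- Interpolation at the breakpoints by hinges min(x , bᵢ)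

  sum-*-const : ∀ {r} (a x : Fin r → Carrier) {y} → (∀ i → x i ≈ y) →
    ∑[ i < r ] (a i * x i) ≈ sum a * y
  sum-*-const a x {y} x≈y = trans (sum-cong-≋ (λ i → *-congˡ (x≈y i))) (sym (*-distribʳ-sum y a))

  -- Moves the base point of an expansion: the tail is expanded from the first breakpoint, the whole
  -- from `p`.
  sum-*-shift : ∀ {r} (a x : Fin r → Carrier) p q →
    ∑[ i < r ] (a i * (x i - p)) ≈ ∑[ i < r ] (a i * (x i - q)) + sum a * (q - p)
  sum-*-shift {r} a x p q = begin-equality
    ∑[ i < r ] (a i * (x i - p))
      ≈⟨ sum-cong-≋ (λ i → solve 4 (λ a x p q → a :* (x :- p) := a :* (x :- q) :+ a :* (q :- p)) refl (a i) (x i) p q) ⟩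
    ∑[ i < r ] (a i * (x i - q) + a i * (q - p))
      ≈⟨ ∑-distrib-+ (λ i → a i * (x i - q)) (λ i → a i * (q - p)) ⟩
    ∑[ i < r ] (a i * (x i - q)) + ∑[ i < r ] (a i * (q - p))
      ≈⟨ +-congˡ (*-distribʳ-sum (q - p) a) ⟨
    ∑[ i < r ] (a i * (x i - q)) + sum a * (q - p) ∎

  -- `D` is the range on which f increases: [0 , bᵣ] for the function corrected by k x, the lower
  -- half of [0 , M] in the symmetric case.
  module _ {d} (D : Pred Carrier d) (f : Carrier → Carrier)
    (f-mono : ∀ {x y} → D x → D y → x < y → f x ≤ f y)
    (f-above : ∀ {x y z} → D x → D y → D z → x < y → y < z → AboveChord f x y z)
    where

    -- All hinges of the tail have their kinks at or after its first breakpoint, so on the segment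
    -- leading there each rises with slope 1, and f has slope `sum a′`. Concavity bounds this by the
    -- slope on [p , b₀], which is what makes the coefficient at b₀ nonnegative.
    sum≤slope : ∀ {r p} (b : Fin (suc r) → Carrier) (a′ : Fin r → Carrier) →
      D p → (∀ i → D (b i)) → p < b zero → (∀ {i j} → i Fin.< j → b i < b j) →
      (∀ j → f (b (suc j)) ≈ f (b zero) + ∑[ i < r ] (a′ i * ((b (suc j) ⊓ b (suc i)) - b zero))) →
      (b zero - p) * sum a′ ≤ f (b zero) - f p
    -- After the last breakpoint the slope is 0; monotonicity takes the place of a further chord.
    sum≤slope {zero} b a′ Dp Db p<b₀ b-inc eq′ =
      ≤-respˡ-≈ (sym (zeroʳ _)) (x≤y⇒0≤y-x (f-mono Dp (Db zero) p<b₀))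
    sum≤slope {suc r} {p} b a′ Dp Db p<b₀ b-inc eq′ = *-cancelˡ-≤ (x<y⇒0<y-x b₀<b₁) (begin
      (b₁ - b₀) * ((b₀ - p) * sum a′)
        ≈⟨ solve 5 (λ p b₀ b₁ σ v → (b₁ :- b₀) :* ((b₀ :- p) :* σ)
                                 := (b₀ :- p) :* (v :+ σ :* (b₁ :- b₀)) :- (b₀ :- p) :* v) refl p b₀ b₁ (sum a′) (f b₀) ⟩
      (b₀ - p) * (f b₀ + sum a′ * (b₁ - b₀)) - (b₀ - p) * f b₀
        ≈⟨ +-congʳ (*-congˡ fb₁≈) ⟨
      (b₀ - p) * f b₁ - (b₀ - p) * f b₀
        ≈⟨ solve 6 (λ p b₀ b₁ u v w → (b₀ :- p) :* w :- (b₀ :- p) :* v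
               := (b₁ :- b₀) :* u :+ (b₀ :- p) :* w :+ (:- ((b₁ :- b₀) :* u :+ (b₀ :- p) :* v)))
             refl p b₀ b₁ (f p) (f b₀) (f b₁) ⟩
      (b₁ - b₀) * f p + (b₀ - p) * f b₁ + - ((b₁ - b₀) * f p + (b₀ - p) * f b₀)
        ≤⟨ +-mono-≤ (f-above Dp (Db zero) (Db (suc zero)) p<b₀ b₀<b₁) ≤-refl ⟩
      (b₁ - p) * f b₀ + - ((b₁ - b₀) * f p + (b₀ - p) * f b₀)
        ≈⟨ solve 5 (λ p b₀ b₁ u v → (b₁ :- p) :* v :+ (:- ((b₁ :- b₀) :* u :+ (b₀ :- p) :* v))
               := (b₁ :- b₀) :* (v :- u))
             refl p b₀ b₁ (f p) (f b₀) ⟩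
      (b₁ - b₀) * (f b₀ - f p) ∎)
      where
      b₀ b₁ : Carrier
      b₀ = b zero
      b₁ = b (suc zero)
      b₀<b₁ : b₀ < b₁
      b₀<b₁ = b-inc {zero} {suc zero} ℕ.z<s
      b₁≤b : ∀ i → b₁ ≤ b (suc i)
      b₁≤b zero    = ≤-refl
      b₁≤b (suc i) = proj₁ (b-inc {suc zero} {suc (suc i)} (ℕ.s<s ℕ.z<s))
      fb₁≈ : f b₁ ≈ f b₀ + sum a′ * (b₁ - b₀)
      fb₁≈ = trans (eq′ zero) (+-congˡ (sum-*-const a′ _ (λ i → +-congʳ (x≤y⇒x⊓y≈x (b₁≤b i)))))

    -- The coefficient of the kink at b i is the drop of slope there; from the
    -- left, the slope on the first segment is the sum of all coefficients.
    interpolate : ∀ {r} p (b : Fin r → Carrier) → D p → (∀ i → D (b i)) →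
      (∀ i → p < b i) → (∀ {i j} → i Fin.< j → b i < b j) →
      ∃ λ (a : Fin r → Carrier) → (∀ i → 0# ≤ a i) ×
        (∀ j → f (b j) ≈ f p + ∑[ i < r ] (a i * ((b j ⊓ b i) - p)))
    interpolate {zero}  p b Dp Db p<b b-inc = (λ ()) , (λ ()) , (λ ())
    interpolate {suc r} p b Dp Db p<b b-inc
      -- The first breakpoint becomes the base point of the tail, hence the general `p`.
      with a′ , 0≤a′ , eq′ ← interpolate (b zero) (b ∘ suc) (Db zero) (Db ∘ suc)
                               (λ i → b-inc {zero} {suc i} ℕ.z<s) (λ i<j → b-inc (ℕ.s<s i<j))
      = a , 0≤a , eq
      where
      b₀ σ s : Carrier
      b₀ = b zero
      σ = sum a′
      s = (f b₀ - f p) * (b₀ - p) ⁻¹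
      0<b₀-p : 0# < b₀ - p
      0<b₀-p = x<y⇒0<y-x (p<b zero)
      [b₀-p]*s≈ : (b₀ - p) * s ≈ f b₀ - f p
      [b₀-p]*s≈ = x*[y*x⁻¹]≈y (f b₀ - f p) 0<b₀-p

      b₀≤b : ∀ i → b₀ ≤ b i
      b₀≤b zero    = ≤-refl
      b₀≤b (suc i) = proj₁ (b-inc {zero} {suc i} ℕ.z<s)

      a : Fin (suc r) → Carrier
      a zero    = s - σ
      a (suc i) = a′ i

      0≤a : ∀ i → 0# ≤ a i
      0≤a zero    = x≤y⇒0≤y-x (*-cancelˡ-≤ 0<b₀-p
        (≤-respʳ-≈ (sym [b₀-p]*s≈) (sum≤slope b a′ Dp Db (p<b zero) b-inc eq′)))
      0≤a (suc i) = 0≤a′ i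

      -- Rebasing the tail at `p` costs σ (b₀ - p); the new hinge tops this up to s (b₀ - p), the
      -- increment of f on the first segment. `τ` is the tail seen from b₀, and it is 0 at b₀
      -- itself.
      first-segment : ∀ τ → f p + ((s - σ) * (b₀ - p) + (τ + σ * (b₀ - p))) ≈ f b₀ + τ
      first-segment τ = begin-equality
        f p + ((s - σ) * (b₀ - p) + (τ + σ * (b₀ - p)))
          ≈⟨ solve 5 (λ u s σ h τ → u :+ ((s :- σ) :* h :+ (τ :+ σ :* h)) := u :+ h :* s :+ τ)
               refl (f p) s σ (b₀ - p) τ ⟩
        f p + (b₀ - p) * s + τ
          ≈⟨ +-congʳ (+-congˡ [b₀-p]*s≈) ⟩
        f p + (f b₀ - f p) + τ
          ≈⟨ +-congʳ (solve 2 (λ u v → u :+ (v :- u) := v) refl (f p) (f b₀)) ⟩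
        f b₀ + τ ∎

      eq : ∀ j → f (b j) ≈ f p + ∑[ i < suc r ] (a i * ((b j ⊓ b i) - p))
      eq zero = sym (begin-equality
        f p + ∑[ i < suc r ] (a i * ((b₀ ⊓ b i) - p))
          ≈⟨ +-congˡ (+-cong (*-congˡ (+-congʳ (⊓-idem b₀)))
               (trans (sum-*-const a′ _ (λ i → +-congʳ (x≤y⇒x⊓y≈x (b₀≤b (suc i))))) (sym (+-identityˡ _)))) ⟩
        f p + ((s - σ) * (b₀ - p) + (0# + σ * (b₀ - p)))
          ≈⟨ first-segment 0# ⟩
        f b₀ + 0#
          ≈⟨ +-identityʳ (f b₀) ⟩
        f b₀ ∎)
      eq (suc j) = sym (begin-equality
        f p + ∑[ i < suc r ] (a i * ((b (suc j) ⊓ b i) - p))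
          ≈⟨ +-congˡ (+-cong (*-congˡ (+-congʳ (x≤y⇒y⊓x≈x (b₀≤b (suc j)))))
               (sum-*-shift a′ (λ i → b (suc j) ⊓ b (suc i)) p b₀)) ⟩
        f p + ((s - σ) * (b₀ - p) + (τ + σ * (b₀ - p)))
          ≈⟨ first-segment τ ⟩
        f b₀ + τ
          ≈⟨ eq′ j ⟨
        f (b (suc j)) ∎)
        where
        τ : Carrier
        τ = ∑[ i < r ] (a′ i * ((b (suc j) ⊓ b (suc i)) - b₀))

    interpolate₀ : ∀ {r} (b : Fin r → Carrier) → D 0# → f 0# ≈ 0# → (∀ i → D (b i)) →
      (∀ i → 0# < b i) → (∀ {i j} → i Fin.< j → b i < b j) →
      ∃ λ (a : Fin r → Carrier) → (∀ i → 0# ≤ a i) ×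
        (∀ j → f (b j) ≈ ∑[ i < r ] (a i * (b j ⊓ b i)))
    interpolate₀ {r} b D0 f0≈0 Db 0<b b-inc
      with a , 0≤a , eq ← interpolate 0# b D0 Db 0<b b-inc
      = a , 0≤a , λ j → begin-equality
        f (b j)
          ≈⟨ eq j ⟩
        f 0# + ∑[ i < r ] (a i * ((b j ⊓ b i) - 0#))
          ≈⟨ +-cong f0≈0 (sum-cong-≋ λ i → *-congˡ {a i}
               (solve 1 (λ x → x :- con (+ 0) := x) refl (b j ⊓ b i))) ⟩
        0# + ∑[ i < r ] (a i * (b j ⊓ b i))
          ≈⟨ +-identityˡ _ ⟩
        ∑[ i < r ] (a i * (b j ⊓ b i)) ∎

  -- Strictly sorted lists and the enumeration of sets of subset weights

  strictTotalOrder : StrictTotalOrder c ℓ₁ _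
  strictTotalOrder = record
    { isStrictTotalOrder = ToStrict.<-isStrictTotalOrder₂ _≈_ _≤_ isDecTotalOrder }

  open StrictTotalOrder strictTotalOrder using (compare) renaming (trans to <-trans)

  -- A value already present up to `≈` is dropped: different subsets may have equal weight, and each
  -- element of Q has to be counted once.
  insert : Carrier → List Carrier → List Carrier
  insert x []       = x ∷ []
  insert x (y ∷ ys) with compare x y
  ... | tri< _ _ _ = x ∷ y ∷ ys
  ... | tri≈ _ _ _ = y ∷ ys
  ... | tri> _ _ _ = y ∷ insert x ys

  insert-all : ∀ {p} {P : Pred Carrier p} {x ys} → P x → All P ys → All P (insert x ys)
  insert-all {ys = []}     px []         = px ∷ []
  insert-all {x = x} {ys = y ∷ ys} px (py ∷ pys) with compare x y
  ... | tri< _ _ _ = px ∷ py ∷ pys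
  ... | tri≈ _ _ _ = py ∷ pys
  ... | tri> _ _ _ = py ∷ insert-all px pys

  insert-increasing : ∀ {x ys} → AllPairs _<_ ys → AllPairs _<_ (insert x ys)
  insert-increasing {ys = []}    []         = [] ∷ []
  insert-increasing {x} {y ∷ ys} (y<ys ∷ p) with compare x y
  ... | tri< x<y _ _ = (x<y ∷ All.map (<-trans x<y) y<ys) ∷ y<ys ∷ p
  ... | tri≈ _ _ _   = y<ys ∷ p
  ... | tri> _ _ y<x = insert-all y<x y<ys ∷ insert-increasing p

  insert-here : ∀ x ys → Any (x ≈_) (insert x ys)
  insert-here x []       = here refl
  insert-here x (y ∷ ys) with compare x y
  ... | tri< _ _ _   = here refl
  ... | tri≈ _ x≈y _ = here x≈y
  ... | tri> _ _ _   = there (insert-here x ys)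

  insert-there : ∀ {p} {P : Pred Carrier p} x {ys} → Any P ys → Any P (insert x ys)
  insert-there x {y ∷ ys} p with compare x y
  insert-there x p         | tri< _ _ _ = there p
  insert-there x p         | tri≈ _ _ _ = p
  insert-there x (here p)  | tri> _ _ _ = here p
  insert-there x (there p) | tri> _ _ _ = there (insert-there x p)

  sort : List Carrier → List Carrier
  sort = foldr insert []

  sort-all : ∀ {p} {P : Pred Carrier p} {xs} → All P xs → All P (sort xs)
  sort-all []         = []
  sort-all (px ∷ pxs) = insert-all px (sort-all pxs)

  sort-increasing : ∀ xs → AllPairs _<_ (sort xs)
  sort-increasing []       = []
  sort-increasing (x ∷ xs) = insert-increasing (sort-increasing xs)

  sort-complete : ∀ {x xs} → x ∈ xs → Any (x ≈_) (sort xs)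
  sort-complete {xs = x ∷ xs} (here ≡.refl) = insert-here x (sort xs)
  sort-complete {xs = y ∷ xs} (there x∈xs)  = insert-there y (sort-complete x∈xs)

  lookup-increasing : ∀ {xs} → AllPairs _<_ xs →
    ∀ {i j} → i Fin.< j → List.lookup xs i < List.lookup xs j
  lookup-increasing (x<xs ∷ _) {zero}  {suc j} _   = All.lookup x<xs (∈-lookup j)
  lookup-increasing (_ ∷ xs)   {suc i} {suc j} i<j = lookup-increasing xs (ℕ.s<s⁻¹ i<j)

  -- Q is presented by the subsets that realise its elements, so it is listed by filtering all
  -- subsets with the decidable P and sorting their values.
  enumerate : ∀ {n p q} {P : Pred (Subset n) p} (P? : Decidable P) (f : Subset n → Carrier)
    {Q : Pred Carrier q} → (∀ S → P S → Q (f S)) → (∀ {x} → Q x → ∃[ S ] P S × x ≈ f S) →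
    ∃ λ r → ∃ λ (b : Fin r → Carrier) → IncreasinglyEnumerates Q b
  enumerate {n} P? f {Q} P⇒Q Q⇒P = length xs , List.lookup xs , record
    { increasing = lookup-increasing (sort-increasing ys)
    ; sound      = λ i → All.lookup (sort-all {P = Q} (All.map⁺ (All.map (P⇒Q _) (All.all-filter P? (subsets n))))) (∈-lookup i)
    ; complete   = λ Qx → let S , PS , x≈fS = Q⇒P Qx
                              fS∈xs = sort-complete (∈-map⁺ f (∈-filter⁺ P? (∈-subsets S) PS))
                          in Any.index fS∈xs , trans x≈fS (Any.lookup-index fS∈xs)
    }
    where
    ys = map f (filter P? (subsets n))
    xs = sort ys

  -- Cuts as double sums over vertices

  sum-zero : ∀ {n} {f : Fin n → Carrier} → (∀ i → f i ≈ 0#) → sum f ≈ 0#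
  sum-zero {n} f≈0 = trans (sum-cong-≋ f≈0) (sum-replicate-zero n)

  sum-↑ : ∀ m {k} (f : Fin (m ℕ.+ k) → Carrier) →
    sum f ≈ sum (λ i → f (i ↑ˡ k)) + sum (λ j → f (m ↑ʳ j))
  sum-↑ zero    f = sym (+-identityˡ _)
  sum-↑ (suc m) f = trans (+-congˡ (sum-↑ m (f ∘ suc))) (sym (+-assoc _ _ _))

  sumᵛ-cong : ∀ {n m} {f h : Vertex n m → Carrier} → (∀ u → f u ≈ h u) → sumᵛ f ≈ sumᵛ h
  sumᵛ-cong f≈h = +-cong (sum-cong-≋ (f≈h ∘ inj₁)) (sum-cong-≋ (f≈h ∘ inj₂))

  sumᵛ-zero : ∀ {n m} {f : Vertex n m → Carrier} → (∀ u → f u ≈ 0#) → sumᵛ f ≈ 0#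
  sumᵛ-zero f≈0 = trans (+-cong (sum-zero (f≈0 ∘ inj₁)) (sum-zero (f≈0 ∘ inj₂))) (+-identityˡ 0#)

  sumᵛ-+ : ∀ {n m} (f h : Vertex n m → Carrier) → sumᵛ (λ u → f u + h u) ≈ sumᵛ f + sumᵛ h
  sumᵛ-+ f h = begin-equality
    sumᵛ (λ u → f u + h u)
      ≈⟨ +-cong (∑-distrib-+ (f ∘ inj₁) (h ∘ inj₁)) (∑-distrib-+ (f ∘ inj₂) (h ∘ inj₂)) ⟩
    (sum (f ∘ inj₁) + sum (h ∘ inj₁)) + (sum (f ∘ inj₂) + sum (h ∘ inj₂))
      ≈⟨ solve 4 (λ a b c d → (a :+ b) :+ (c :+ d) := (a :+ c) :+ (b :+ d)) refl _ _ _ _ ⟩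
    sumᵛ f + sumᵛ h ∎

  if-cong : ∀ {b b′ x y} → b ≡ b′ → x ≈ y → (if b then x else 0#) ≈ (if b′ then y else 0#)
  if-cong {true}  ≡.refl x≈y = x≈y
  if-cong {false} ≡.refl x≈y = refl

  if-zero : ∀ b {x} → x ≈ 0# → (if b then x else 0#) ≈ 0#
  if-zero true  x≈0 = x≈0
  if-zero false x≈0 = refl

  if-+ : ∀ b x y → (if b then x + y else 0#) ≈ (if b then x else 0#) + (if b then y else 0#)
  if-+ true  _ _ = refl
  if-+ false _ _ = sym (+-identityˡ 0#)

  cut-cong : ∀ {n} (G : Gadget n) {T T′} → (∀ u → T u ≡ T′ u) → cut G T ≈ cut G T′
  cut-cong G T≗T′ = sumᵛ-cong λ u → sumᵛ-cong λ v →
    if-cong (≡.cong₂ (λ s t → s ∧ not t) (T≗T′ u) (T≗T′ v)) (refl {weight G u v})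

  -- Unions of gadgets

  left : ∀ {n m} k → Vertex n m → Vertex n (m ℕ.+ k)
  left k (inj₁ v) = inj₁ v
  left k (inj₂ i) = inj₂ (i ↑ˡ k)

  right : ∀ {n} m {k} → Vertex n k → Vertex n (m ℕ.+ k)
  right m (inj₁ v) = inj₁ v
  right m (inj₂ j) = inj₂ (m ↑ʳ j)

  leftPart-left : ∀ {n m} k (u : Vertex n m) → leftPart m (left k u) ≡ just u
  leftPart-left         k (inj₁ v) = ≡.refl
  leftPart-left {m = m} k (inj₂ i) rewrite splitAt-↑ˡ m i k = ≡.refl

  rightPart-right : ∀ {n} m {k} (u : Vertex n k) → rightPart m (right m u) ≡ just u
  rightPart-right m     (inj₁ v) = ≡.refl
  rightPart-right m {k} (inj₂ j) rewrite splitAt-↑ʳ m k j = ≡.refl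

  leftPart-↑ʳ : ∀ {n} m {k} (j : Fin k) → leftPart {n} m (inj₂ (m ↑ʳ j)) ≡ nothing
  leftPart-↑ʳ m {k} j rewrite splitAt-↑ʳ m k j = ≡.refl

  rightPart-↑ˡ : ∀ {n m} k (i : Fin m) → rightPart {n} m (inj₂ (i ↑ˡ k)) ≡ nothing
  rightPart-↑ˡ {m = m} k i rewrite splitAt-↑ˡ m i k = ≡.refl

  sumᵛ-left : ∀ {n m} k (f : Vertex n (m ℕ.+ k) → Carrier) →
    (∀ j → f (inj₂ (m ↑ʳ j)) ≈ 0#) → sumᵛ f ≈ sumᵛ (f ∘ left k)
  sumᵛ-left {m = m} k f f≈0 = +-congˡ (begin-equality
    sum (f ∘ inj₂)                            ≈⟨ sum-↑ m (f ∘ inj₂) ⟩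
    _ + sum (λ j → f (inj₂ (m ↑ʳ j)))         ≈⟨ +-congˡ (sum-zero f≈0) ⟩
    sum (λ i → f (inj₂ (i ↑ˡ k))) + 0#        ≈⟨ +-identityʳ _ ⟩
    sum (λ i → f (inj₂ (i ↑ˡ k)))             ∎)

  sumᵛ-right : ∀ {n} m {k} (f : Vertex n (m ℕ.+ k) → Carrier) →
    (∀ i → f (inj₂ (i ↑ˡ k)) ≈ 0#) → sumᵛ f ≈ sumᵛ (f ∘ right m)
  sumᵛ-right m {k} f f≈0 = +-congˡ (begin-equality
    sum (f ∘ inj₂)                            ≈⟨ sum-↑ m (f ∘ inj₂) ⟩
    sum (λ i → f (inj₂ (i ↑ˡ k))) + _         ≈⟨ +-congʳ (sum-zero f≈0) ⟩
    0# + sum (λ j → f (inj₂ (m ↑ʳ j)))        ≈⟨ +-identityˡ _ ⟩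
    sum (λ j → f (inj₂ (m ↑ʳ j)))             ∎)

  weight?-nothingʳ : ∀ {n} (G : Gadget n) u → weight? G u nothing ≈ 0#
  weight?-nothingʳ G (just _) = refl
  weight?-nothingʳ G nothing  = refl

  -- A cut is additive in the weights. In the summand of one gadget the auxiliary vertices of the
  -- other index zero rows and zero columns; deleting these leaves the cut of that gadget alone.
  cut-∪ : ∀ {n} (G H : Gadget n) T →
    cut (G ∪ H) T ≈ cut G (T ∘ left (#aux H)) + cut H (T ∘ right (#aux G))
  cut-∪ {n} G H T = begin-equality
    cut (G ∪ H) T
      ≈⟨ sumᵛ-cong (λ u → trans
           (sumᵛ-cong (λ v → if-+ (T u ∧ not (T v))
             (weight? G (leftPart m u) (leftPart m v)) (weight? H (rightPart m u) (rightPart m v))))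
           (sumᵛ-+ (A u) (B u))) ⟩
    sumᵛ (λ u → sumᵛ (A u) + sumᵛ (B u))
      ≈⟨ sumᵛ-+ (λ u → sumᵛ (A u)) (λ u → sumᵛ (B u)) ⟩
    sumᵛ (λ u → sumᵛ (A u)) + sumᵛ (λ u → sumᵛ (B u))
      ≈⟨ +-cong sumA sumB ⟩
    cut G (T ∘ left (#aux H)) + cut H (T ∘ right (#aux G)) ∎
    where
    m k : ℕ
    m = #aux G
    k = #aux H
    A B : Vertex n (m ℕ.+ k) → Vertex n (m ℕ.+ k) → Carrier
    A u v = if T u ∧ not (T v) then weight? G (leftPart m u) (leftPart m v) else 0#
    B u v = if T u ∧ not (T v) then weight? H (rightPart m u) (rightPart m v) else 0#

    sumA : sumᵛ (λ u → sumᵛ (A u)) ≈ cut G (T ∘ left k)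
    sumA = begin-equality
      sumᵛ (λ u → sumᵛ (A u))
        ≈⟨ sumᵛ-left k (λ u → sumᵛ (A u)) (λ j → sumᵛ-zero (λ v → if-zero (T (inj₂ (m ↑ʳ j)) ∧ not (T v))
             (reflexive (≡.cong (λ u → weight? G u (leftPart m v)) (leftPart-↑ʳ m j))))) ⟩
      sumᵛ (λ u → sumᵛ (A (left k u)))
        ≈⟨ sumᵛ-cong (λ u → sumᵛ-left k (A (left k u)) (λ j → if-zero (T (left k u) ∧ not (T (inj₂ (m ↑ʳ j))))
             (trans (reflexive (≡.cong (weight? G (leftPart m (left k u))) (leftPart-↑ʳ m j)))
                    (weight?-nothingʳ G (leftPart m (left k u)))))) ⟩
      sumᵛ (λ u → sumᵛ (λ v → A (left k u) (left k v)))
        ≈⟨ sumᵛ-cong (λ u → sumᵛ-cong (λ v → if-cong {T (left k u) ∧ not (T (left k v))} ≡.refl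
             (reflexive (≡.cong₂ (weight? G) (leftPart-left k u) (leftPart-left k v))))) ⟩
      cut G (T ∘ left k) ∎

    sumB : sumᵛ (λ u → sumᵛ (B u)) ≈ cut H (T ∘ right m)
    sumB = begin-equality
      sumᵛ (λ u → sumᵛ (B u))
        ≈⟨ sumᵛ-right m (λ u → sumᵛ (B u)) (λ i → sumᵛ-zero (λ v → if-zero (T (inj₂ (i ↑ˡ k)) ∧ not (T v))
             (reflexive (≡.cong (λ u → weight? H u (rightPart m v)) (rightPart-↑ˡ k i))))) ⟩
      sumᵛ (λ u → sumᵛ (B (right m u)))
        ≈⟨ sumᵛ-cong (λ u → sumᵛ-right m (B (right m u)) (λ i → if-zero (T (right m u) ∧ not (T (inj₂ (i ↑ˡ k))))
             (trans (reflexive (≡.cong (weight? H (rightPart m (right m u))) (rightPart-↑ˡ k i)))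
                    (weight?-nothingʳ H (rightPart m (right m u)))))) ⟩
      sumᵛ (λ u → sumᵛ (λ v → B (right m u) (right m v)))
        ≈⟨ sumᵛ-cong (λ u → sumᵛ-cong (λ v → if-cong {T (right m u) ∧ not (T (right m v))} ≡.refl
             (reflexive (≡.cong₂ (weight? H) (rightPart-right m u) (rightPart-right m v))))) ⟩
      cut H (T ∘ right m) ∎

  splitting-cong : ∀ {n} {G : Gadget n} {w w′} → (∀ S → w S ≈ w′ S) →
    IsGadgetSplittingFunction G w → IsGadgetSplittingFunction G w′
  splitting-cong w≈w′ G-splits S with (T , T∩e , cut≈) , minimal ← G-splits S =
    (T , T∩e , trans cut≈ (w≈w′ S)) , λ T T∩e → ≤-respˡ-≈ (w≈w′ S) (minimal T T∩e)

  splitting-edgeless : ∀ {n} → IsGadgetSplittingFunction (edgeless {n}) (λ _ → 0#)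
  splitting-edgeless S =
    ([ lookup S , (λ ()) ]′ , (λ _ → ≡.refl) , cut≈0 [ lookup S , (λ ()) ]′) , λ T _ → ≤-reflexive (sym (cut≈0 T))
    where
    cut≈0 : ∀ T → cut edgeless T ≈ 0#
    cut≈0 T = sumᵛ-zero λ u → sumᵛ-zero λ v → if-zero (T u ∧ not (T v)) refl

  splitting-∪ : ∀ {n} {G H : Gadget n} {w w′} →
    IsGadgetSplittingFunction G w → IsGadgetSplittingFunction H w′ →
    IsGadgetSplittingFunction (G ∪ H) (λ S → w S + w′ S)
  splitting-∪ {n} {G} {H} G-splits H-splits S
    with (T , T∩e , cut≈) , minimal ← G-splits S | (T′ , T′∩e , cut′≈) , minimal′ ← H-splits S
    = (T∪T′ , (λ _ → ≡.refl) , trans (cut-∪ G H T∪T′)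
        (+-cong (trans (cut-cong G T∪T′-left) cut≈) (trans (cut-cong H T∪T′-right) cut′≈)))
    , λ U U∩e → ≤-respʳ-≈ (sym (cut-∪ G H U)) (+-mono-≤ (minimal (U ∘ left (#aux H)) U∩e) (minimal′ (U ∘ right (#aux G)) U∩e))
    where
    T∪T′ : VertexSet n (#aux G ℕ.+ #aux H)
    -- On e the glued set is read off S itself; `T` and `T′` agree with it there, which is why they
    -- can be glued.
    T∪T′ (inj₁ v) = lookup S v
    T∪T′ (inj₂ x) = [ T ∘ inj₂ , T′ ∘ inj₂ ]′ (splitAt (#aux G) x)
    T∪T′-left : ∀ u → T∪T′ (left (#aux H) u) ≡ T u
    T∪T′-left (inj₁ v) = ≡.sym (T∩e v)
    T∪T′-left (inj₂ i) = ≡.cong [ T ∘ inj₂ , T′ ∘ inj₂ ]′ (splitAt-↑ˡ (#aux G) i (#aux H))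
    T∪T′-right : ∀ u → T∪T′ (right (#aux G) u) ≡ T′ u
    T∪T′-right (inj₁ v) = ≡.sym (T′∩e v)
    T∪T′-right (inj₂ j) = ≡.cong [ T ∘ inj₂ , T′ ∘ inj₂ ]′ (splitAt-↑ʳ (#aux G) (#aux H) j)

  sumˡ : List Carrier → Carrier
  sumˡ = foldr _+_ 0#

  -- Indexed by a list, so that the union of all gadgets and the union without the zero coefficients
  -- are both instances.
  splitting-⋃ : ∀ {n i} {I : Set i} {G : I → Gadget n} {w : I → Subset n → Carrier} →
    (∀ i → IsGadgetSplittingFunction (G i) (w i)) → ∀ is →
    IsGadgetSplittingFunction (⋃ (map G is)) (λ S → sumˡ (map (λ i → w i S) is))
  splitting-⋃ G-splits []       = splitting-edgeless
  splitting-⋃ {G = G} G-splits (i ∷ is) = splitting-∪ {G = G i} (G-splits i) (splitting-⋃ G-splits is)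

  sumˡ-tabulate : ∀ {r} (f : Fin r → Carrier) → sumˡ (tabulate f) ≈ sum f
  sumˡ-tabulate {zero}  f = refl
  sumˡ-tabulate {suc r} f = +-congˡ (sumˡ-tabulate (f ∘ suc))

  sumˡ-allFin : ∀ {r} (f : Fin r → Carrier) → sumˡ (map f (allFin r)) ≈ sum f
  sumˡ-allFin f = trans (reflexive (≡.cong sumˡ (List.map-tabulate id f))) (sumˡ-tabulate f)

  sumˡ-filter : ∀ {i p} {I : Set i} {P : Pred I p} (P? : Decidable P) {f : I → Carrier} →
    (∀ i → ¬ P i → f i ≈ 0#) → ∀ is → sumˡ (map f (filter P? is)) ≈ sumˡ (map f is)
  sumˡ-filter P? f≈0 []       = refl
  sumˡ-filter P? f≈0 (i ∷ is) with P? i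
  ... | yes _  = +-congˡ (sumˡ-filter P? f≈0 is)
  ... | no ¬Pi = trans (sumˡ-filter P? f≈0 is) (sym (trans (+-congʳ (f≈0 i ¬Pi)) (+-identityˡ _)))

  nonNegative-weight? : ∀ {n} {G : Gadget n} → NonNegativeWeights G → ∀ u v → 0# ≤ weight? G u v
  nonNegative-weight? 0≤G (just u) (just v) = 0≤G u v
  nonNegative-weight? 0≤G (just _) nothing  = ≤-refl
  nonNegative-weight? 0≤G nothing  _        = ≤-refl

  nonNegative-⋃ : ∀ {n} {Gs : List (Gadget n)} → All NonNegativeWeights Gs → NonNegativeWeights (⋃ Gs)
  nonNegative-⋃ []                _ _ = ≤-refl
  nonNegative-⋃ (_∷_ {x = G} {xs = Gs} 0≤G 0≤Gs) u v = +-nonNegative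
    (nonNegative-weight? {G = G} 0≤G (leftPart (#aux G) u) (leftPart (#aux G) v))
    (nonNegative-weight? {G = ⋃ Gs} (nonNegative-⋃ 0≤Gs) (rightPart (#aux G) u) (rightPart (#aux G) v))

  -- EDVWs-based gadgets

  *-distribˡ-⊓ : ∀ {a} → 0# ≤ a → ∀ x y → a * (x ⊓ y) ≈ (a * x) ⊓ (a * y)
  *-distribˡ-⊓ 0≤a = mono-≤-distrib-⊓ *-congˡ (*-monoˡ-≤ 0≤a)

  x≤x+y : ∀ {x y} → 0# ≤ y → x ≤ x + y
  x≤x+y {x} 0≤y = ≤-respˡ-≈ (+-identityʳ x) (+-monoʳ-≤ x 0≤y)

  *-if : ∀ a b {x} → a * (if b then x else 0#) ≈ (if b then a * x else 0#)
  *-if a true  = refl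
  *-if a false = zeroʳ a

  -- Here `t` is the side of one auxiliary vertex, and the edges form a star joining e to it. Both
  -- kinds of gadget consist of one entering and one leaving star, the symmetric one having an extra
  -- edge between its two centres.
  module _ {n} (γ : Fin n → Carrier) {S : Subset n} {T : Fin n → Bool} (T≗S : ∀ v → T v ≡ lookup S v) where

    sum-leaving : ∀ a t → sum (λ v → if T v ∧ not t then a * γ v else 0#)
                        ≈ (if not t then a * ⟦ γ ⟧ S else 0#)
    sum-leaving a true  = sum-zero (λ v → if-cong {b′ = false} (∧-zeroʳ (T v)) (refl {a * γ v}))
    sum-leaving a false = trans
      (sum-cong-≋ λ v → trans (if-cong (≡.trans (∧-identityʳ (T v)) (T≗S v)) refl) (sym (*-if a (lookup S v))))
      (sym (*-distribˡ-sum a (λ v → if lookup S v then γ v else 0#)))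

    sum-entering : ∀ a t → sum (λ v → if t ∧ not (T v) then a * γ v else 0#)
                         ≈ (if t then a * ⟦ γ ⟧ (∁ S) else 0#)
    sum-entering a false = sum-zero {n} (λ v → refl)
    sum-entering a true  = trans
      (sum-cong-≋ λ v → trans
        (if-cong (≡.trans (≡.cong not (T≗S v)) (≡.sym (lookup-map v not S))) refl)
        (sym (*-if a (lookup (∁ S) v))))
      (sym (*-distribˡ-sum a (λ v → if lookup (∁ S) v then γ v else 0#)))

  cut-asymmetric : ∀ {n} (γ : Fin n → Carrier) a b {S T} → T ∩e≡ S →
    cut (asymmetricGadget γ a b) T ≈
      (if not (T (inj₂ zero)) then a * ⟦ γ ⟧ S else 0#) + (if T (inj₂ zero) then b * ⟦ γ ⟧ (∁ S) else 0#)
  cut-asymmetric γ a b {S} {T} T∩e = +-cong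
    (trans (sum-cong-≋ λ u → trans
        (+-cong (sum-zero λ v → if-zero (T (inj₁ u) ∧ not (T (inj₁ v))) refl) (+-identityʳ _))
        (+-identityˡ _))
      (sum-leaving γ {S} T∩e a t))
    (trans (+-identityʳ _) (trans
      (+-cong (sum-entering γ {S} T∩e b t) (trans (+-identityʳ _) (if-zero (t ∧ not t) refl)))
      (+-identityʳ _)))
    where
    t : Bool
    t = T (inj₂ zero)

  -- The auxiliary vertex has two positions: outside T it cuts the edges coming from S, inside T the
  -- edges going to the complement of S.
  splitting-asymmetric : ∀ {n} (γ : Fin n → Carrier) a b →
    IsGadgetSplittingFunction (asymmetricGadget γ a b) (λ S → (a * ⟦ γ ⟧ S) ⊓ (b * ⟦ γ ⟧ (∁ S)))
  splitting-asymmetric {n} γ a b S = attained , minimal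
    where
    x y : Carrier
    x = a * ⟦ γ ⟧ S
    y = b * ⟦ γ ⟧ (∁ S)

    extension : Bool → VertexSet n 1
    extension t = [ lookup S , (λ _ → t) ]′

    attained : ∃[ T ] T ∩e≡ S × cut (asymmetricGadget γ a b) T ≈ x ⊓ y
    attained with ⊓-sel x y
    ... | inj₁ x⊓y≈x = extension false , (λ _ → ≡.refl) ,
      trans (cut-asymmetric γ a b {S} {extension false} (λ _ → ≡.refl)) (trans (+-identityʳ x) (sym x⊓y≈x))
    ... | inj₂ x⊓y≈y = extension true , (λ _ → ≡.refl) ,
      trans (cut-asymmetric γ a b {S} {extension true} (λ _ → ≡.refl)) (trans (+-identityˡ y) (sym x⊓y≈y))

    minimal : ∀ T → T ∩e≡ S → x ⊓ y ≤ cut (asymmetricGadget γ a b) T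
    minimal T T∩e = ≤-respʳ-≈ (sym (cut-asymmetric γ a b {S} {T} T∩e)) (bound (T (inj₂ zero)))
      where
      bound : ∀ t → x ⊓ y ≤ (if not t then x else 0#) + (if t then y else 0#)
      bound true  = ≤-respʳ-≈ (sym (+-identityˡ y)) (x⊓y≤y x y)
      bound false = ≤-respʳ-≈ (sym (+-identityʳ x)) (x⊓y≤x x y)

  cut-symmetric : ∀ {n} (γ : Fin n → Carrier) a b {S T} → T ∩e≡ S →
    let p = T (inj₂ zero); q = T (inj₂ (suc zero)) in
    cut (scale a (symmetricGadget γ b)) T ≈
      (if not p then a * ⟦ γ ⟧ S else 0#) +
      ((if p ∧ not q then a * b else 0#) + (if q then a * ⟦ γ ⟧ (∁ S) else 0#))
  cut-symmetric γ a b {S} {T} T∩e = +-cong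
    (trans (sum-cong-≋ λ u → begin-equality
        _ + (_ + (_ + 0#))
          ≈⟨ +-cong (sum-zero λ v → absent (T (inj₁ u) ∧ not (T (inj₁ v))))
                    (+-congˡ (+-congʳ (absent (T (inj₁ u) ∧ not q)))) ⟩
        0# + (_ + (0# + 0#))
          ≈⟨ solve 1 (λ x → con (+ 0) :+ (x :+ (con (+ 0) :+ con (+ 0))) := x) refl _ ⟩
        _ ∎)
      (sum-leaving γ {S} T∩e a p))
    (begin-equality
      (_ + (_ + (_ + 0#))) + ((_ + (_ + (_ + 0#))) + 0#)
        ≈⟨ +-cong (+-cong (sum-zero λ v → absent (p ∧ not (T (inj₁ v)))) (+-congʳ (absent (p ∧ not p))))
                  (+-congʳ (+-cong (sum-entering γ {S} T∩e a q)
                                   (+-cong (absent (q ∧ not p)) (+-congʳ (absent (q ∧ not q)))))) ⟩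
      (0# + (0# + (_ + 0#))) + ((_ + (0# + (0# + 0#))) + 0#)
        ≈⟨ solve 2 (λ x y → (con (+ 0) :+ (con (+ 0) :+ (x :+ con (+ 0))))
                             :+ ((y :+ (con (+ 0) :+ (con (+ 0) :+ con (+ 0)))) :+ con (+ 0))
                          := x :+ y) refl _ _ ⟩
      _ ∎)
    where
    p q : Bool
    p = T (inj₂ zero)
    q = T (inj₂ (suc zero))
    -- Scaling turns a missing edge into one of weight `a * 0#`, which is zero only up to `≈`.
    absent : ∀ b → (if b then a * 0# else 0#) ≈ 0#
    absent b = if-zero b (zeroʳ a)

  -- Of the four placements of the two auxiliary vertices, three realise the three terms of the
  -- minimum: both outside, only the first inside, both inside. The fourth cuts both stars and is
  -- never cheaper.
  splitting-symmetric : ∀ {n} (γ : Fin n → Carrier) {a} b → 0# ≤ a → (∀ S → 0# ≤ ⟦ γ ⟧ S) →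
    IsGadgetSplittingFunction (scale a (symmetricGadget γ b)) (λ S → a * (⟦ γ ⟧ S ⊓ ⟦ γ ⟧ (∁ S) ⊓ b))
  splitting-symmetric {n} γ {a} b 0≤a 0≤γ S = attained , minimal
    where
    x y : Carrier
    x = ⟦ γ ⟧ S
    y = ⟦ γ ⟧ (∁ S)

    extension : Bool → Bool → VertexSet n 2
    extension p q = λ where
      (inj₁ v)       → lookup S v
      (inj₂ zero)    → p
      (inj₂ (suc _)) → q

    cut-extension : ∀ p q → cut (scale a (symmetricGadget γ b)) (extension p q) ≈
      (if not p then a * x else 0#) + ((if p ∧ not q then a * b else 0#) + (if q then a * y else 0#))
    cut-extension p q = cut-symmetric γ a b {S} {extension p q} (λ _ → ≡.refl)

    attained : ∃[ T ] T ∩e≡ S × cut (scale a (symmetricGadget γ b)) T ≈ a * (x ⊓ y ⊓ b)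
    attained with ⊓-sel (x ⊓ y) b | ⊓-sel x y
    ... | inj₂ ≈b   | _         = extension true false , (λ _ → ≡.refl) ,
      trans (cut-extension true false)
        (trans (+-identityˡ _) (trans (+-identityʳ _) (*-congˡ (sym ≈b))))
    ... | inj₁ ≈x⊓y | inj₁ ≈x   = extension false false , (λ _ → ≡.refl) ,
      trans (cut-extension false false)
        (trans (+-congˡ (+-identityˡ _)) (trans (+-identityʳ _) (*-congˡ (sym (trans ≈x⊓y ≈x)))))
    ... | inj₁ ≈x⊓y | inj₂ ≈y   = extension true true , (λ _ → ≡.refl) ,
      trans (cut-extension true true)
        (trans (+-identityˡ _) (trans (+-identityˡ _) (*-congˡ (sym (trans ≈x⊓y ≈y)))))

    minimal : ∀ T → T ∩e≡ S → a * (x ⊓ y ⊓ b) ≤ cut (scale a (symmetricGadget γ b)) T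
    minimal T T∩e = ≤-respʳ-≈ (sym (cut-symmetric γ a b {S} {T} T∩e)) (bound (T (inj₂ zero)) (T (inj₂ (suc zero))))
      where
      ≤x : a * (x ⊓ y ⊓ b) ≤ a * x
      ≤x = *-monoˡ-≤ 0≤a (≤-trans (x⊓y≤x (x ⊓ y) b) (x⊓y≤x x y))
      ≤y : a * (x ⊓ y ⊓ b) ≤ a * y
      ≤y = *-monoˡ-≤ 0≤a (≤-trans (x⊓y≤x (x ⊓ y) b) (x⊓y≤y x y))
      bound : ∀ p q → a * (x ⊓ y ⊓ b) ≤
        (if not p then a * x else 0#) + ((if p ∧ not q then a * b else 0#) + (if q then a * y else 0#))
      bound true  true  = ≤-respʳ-≈ (sym (trans (+-identityˡ _) (+-identityˡ _))) ≤y
      bound true  false = ≤-respʳ-≈ (sym (trans (+-identityˡ _) (+-identityʳ _))) (*-monoˡ-≤ 0≤a (x⊓y≤y (x ⊓ y) b))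
      bound false false = ≤-respʳ-≈ (sym (trans (+-congˡ (+-identityˡ _)) (+-identityʳ _))) ≤x
      -- The fourth placement costs a γ(S) plus the nonnegative cost of the other star.
      bound false true  = ≤-trans ≤x (x≤x+y (+-nonNegative ≤-refl (*-nonNegative 0≤a (0≤γ (∁ S)))))

  nonNegative-asymmetric : ∀ {n} {γ : Fin n → Carrier} {a b} → (∀ v → 0# ≤ γ v) → 0# ≤ a → 0# ≤ b →
    NonNegativeWeights (asymmetricGadget γ a b)
  nonNegative-asymmetric 0≤γ 0≤a 0≤b (inj₁ _) (inj₁ _) = ≤-refl
  nonNegative-asymmetric 0≤γ 0≤a 0≤b (inj₁ v) (inj₂ _) = *-nonNegative 0≤a (0≤γ v)
  nonNegative-asymmetric 0≤γ 0≤a 0≤b (inj₂ _) (inj₁ v) = *-nonNegative 0≤b (0≤γ v)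
  nonNegative-asymmetric 0≤γ 0≤a 0≤b (inj₂ _) (inj₂ _) = ≤-refl

  length-map-allFin : ∀ {a} {A : Set a} {r} (f : Fin r → A) → length (map f (allFin r)) ℕ.≤ r
  length-map-allFin f = ℕ.≤-reflexive (≡.trans (List.length-map f (allFin _)) (List.length-tabulate id))

  -- Weights of subsets

  sum-nonNegative : ∀ {r} {f : Fin r → Carrier} → (∀ i → 0# ≤ f i) → 0# ≤ sum f
  sum-nonNegative {zero}  0≤f = ≤-refl
  sum-nonNegative {suc r} 0≤f = +-nonNegative (0≤f zero) (sum-nonNegative (0≤f ∘ suc))

  ≤-sum : ∀ {r} {f : Fin r → Carrier} → (∀ i → 0# ≤ f i) → ∀ i → f i ≤ sum f
  ≤-sum 0≤f zero    = x≤x+y (sum-nonNegative (0≤f ∘ suc))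
  ≤-sum 0≤f (suc i) = ≤-trans (≤-sum (0≤f ∘ suc) i)
    (≤-respʳ-≈ (+-comm _ _) (x≤x+y (0≤f zero)))

  module SubsetSums {n} (γ : Fin n → Carrier) (0<γ : ∀ v → 0# < γ v) where

    M : Carrier
    M = ⟦ γ ⟧ ⊤

    0≤term : ∀ (S : Subset n) v → 0# ≤ (if lookup S v then γ v else 0#)
    0≤term S v with lookup S v
    ... | true  = proj₁ (0<γ v)
    ... | false = ≤-refl

    0≤⟦γ⟧ : ∀ S → 0# ≤ ⟦ γ ⟧ S
    0≤⟦γ⟧ S = sum-nonNegative (0≤term S)

    0<⟦γ⟧ : ∀ {S} → Nonempty S → 0# < ⟦ γ ⟧ S
    0<⟦γ⟧ {S} (v , v∈S) = 0≤⟦γ⟧ S , λ 0≈γS → proj₂ (0<γ v)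
      (antisym (proj₁ (0<γ v)) (≤-respʳ-≈ (sym 0≈γS) γv≤γS))
      where
      γv≤γS : γ v ≤ ⟦ γ ⟧ S
      γv≤γS = ≤-respˡ-≈ (reflexive (≡.cong (λ b → if b then γ v else 0#) ([]=⇒lookup v∈S)))
        (≤-sum (0≤term S) v)

    ⟦γ⟧-empty : ∀ {S} → ¬ Nonempty S → ⟦ γ ⟧ S ≈ 0#
    ⟦γ⟧-empty {S} S-empty = sum-zero term≈0
      where
      term≈0 : ∀ v → (if lookup S v then γ v else 0#) ≈ 0#
      term≈0 v with lookup S v in eq
      ... | true  = contradiction (v , lookup⇒[]= v S eq) S-empty
      ... | false = refl

    ⟦γ⟧-∁ : ∀ S → ⟦ γ ⟧ S + ⟦ γ ⟧ (∁ S) ≈ M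
    ⟦γ⟧-∁ S = trans (sym (∑-distrib-+ (λ v → if lookup S v then γ v else 0#) _)) (sum-cong-≋ term)
      where
      term : ∀ v → (if lookup S v then γ v else 0#) + (if lookup (∁ S) v then γ v else 0#)
                 ≈ (if lookup (⊤ {n}) v then γ v else 0#)
      term v rewrite lookup-map v not S | lookup-replicate v true with lookup S v
      ... | true  = +-identityʳ (γ v)
      ... | false = +-identityˡ (γ v)

    ⟦γ⟧∈ : ∀ S → ⟦ γ ⟧ S ∈[0, M ]
    ⟦γ⟧∈ S = 0≤⟦γ⟧ S , ≤-respʳ-≈ (⟦γ⟧-∁ S) (x≤x+y (0≤⟦γ⟧ (∁ S)))

    ⟦γ⟧<M : ∀ {S} → S ⊂ ⊤ → ⟦ γ ⟧ S < M
    ⟦γ⟧<M {S} (_ , v , _ , v∉S) = proj₂ (⟦γ⟧∈ S) , λ γS≈M →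
      proj₂ (0<⟦γ⟧ (v , x∉p⇒x∈∁p v∉S)) (begin-equality
        0#                           ≈⟨ -‿inverseʳ (⟦ γ ⟧ S) ⟨
        ⟦ γ ⟧ S - ⟦ γ ⟧ S              ≈⟨ +-congʳ (trans γS≈M (sym (⟦γ⟧-∁ S))) ⟩
        ⟦ γ ⟧ S + ⟦ γ ⟧ (∁ S) - ⟦ γ ⟧ S  ≈⟨ solve 2 (λ x y → x :+ y :- x := y) refl (⟦ γ ⟧ S) (⟦ γ ⟧ (∁ S)) ⟩
        ⟦ γ ⟧ (∁ S)                   ∎)

    -- Interpolation gives values at breakpoints only. The subsets left over are the empty and the
    -- full one, where the boundary values of g take its place.
    trivial⊎Qₐ : ∀ S → ⟦ γ ⟧ S ≈ 0# ⊎ ⟦ γ ⟧ S ≈ M ⊎ Qₐ γ (⟦ γ ⟧ S)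
    trivial⊎Qₐ S with nonempty? S | nonempty? (∁ S)
    ... | no S-empty | _           = inj₁ (⟦γ⟧-empty S-empty)
    ... | yes _      | no ∁S-empty = inj₂ (inj₁ (begin-equality
      ⟦ γ ⟧ S                ≈⟨ +-identityʳ _ ⟨
      ⟦ γ ⟧ S + 0#           ≈⟨ +-congˡ (⟦γ⟧-empty ∁S-empty) ⟨
      ⟦ γ ⟧ S + ⟦ γ ⟧ (∁ S)   ≈⟨ ⟦γ⟧-∁ S ⟩
      M                     ∎))
    ... | yes S-nonempty | yes (v , v∈∁S) =
      inj₂ (inj₂ (S , S-nonempty , (⊆⊤ , v , ∈⊤ , x∈∁p⇒x∉p v∈∁S) , refl))

    Qₐ⇒0< : ∀ {x} → Qₐ γ x → 0# < x
    Qₐ⇒0< (S , S-nonempty , _ , x≈) =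
      ≤-respʳ-≈ (sym x≈) (0≤⟦γ⟧ S) , λ 0≈x → proj₂ (0<⟦γ⟧ S-nonempty) (trans 0≈x x≈)

    Qₐ⇒<M : ∀ {x} → Qₐ γ x → x < M
    Qₐ⇒<M (S , _ , S⊂⊤ , x≈) =
      ≤-respˡ-≈ (sym x≈) (proj₁ (⟦γ⟧<M S⊂⊤)) , λ x≈M → proj₂ (⟦γ⟧<M S⊂⊤) (trans (sym x≈) x≈M)

  -- Hinge expansions of a concave function on [0 , M]

  increasing⇒≤ : ∀ {r} {b : Fin r → Carrier} → (∀ {i j} → i Fin.< j → b i < b j) →
    ∀ {i j} → i Fin.≤ j → b i ≤ b j
  increasing⇒≤ b-inc {i} {j} i≤j with i Fin.≟ j
  ... | yes ≡.refl = ≤-refl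
  ... | no i≢j     = proj₁ (b-inc (Fin.≤∧≢⇒< i≤j i≢j))

  sum-*-0 : ∀ {r} (c b : Fin r → Carrier) {x} → x ≈ 0# → (∀ i → 0# ≤ b i) →
    ∑[ i < r ] (c i * (x ⊓ b i)) ≈ 0#
  sum-*-0 c b x≈0 0≤b = sum-zero λ i →
    trans (*-congˡ (trans (x≤y⇒x⊓y≈x (≤-respˡ-≈ (sym x≈0) (0≤b i))) x≈0)) (zeroʳ (c i))

  -- For y = M - x, the two branches of the minimum differ from M x and M b by the same amount b x.
  *-⊓-tent : ∀ {M x y b} → 0# ≤ M → x + y ≈ M →
    M * (x ⊓ b) ≈ (((M - b) * x) ⊓ (b * y)) + b * x
  *-⊓-tent {M} {x} {y} {b} 0≤M x+y≈M = begin-equality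
    M * (x ⊓ b)
      ≈⟨ *-distribˡ-⊓ 0≤M x b ⟩
    (M * x) ⊓ (M * b)
      ≈⟨ ⊓-cong (solve 3 (λ M x b → M :* x := (M :- b) :* x :+ b :* x) refl M x b)
                (trans (*-congʳ (sym x+y≈M))
                       (solve 3 (λ x y b → (x :+ y) :* b := b :* y :+ b :* x) refl x y b)) ⟩
    ((M - b) * x + b * x) ⊓ (b * y + b * x)
      ≈⟨ mono-≤-distrib-⊓ {f = _+ b * x} +-congʳ (λ u≤v → +-mono-≤ u≤v ≤-refl) ((M - b) * x) (b * y) ⟨
    (((M - b) * x) ⊓ (b * y)) + b * x ∎

  -- The expansion of g(x) + k x. M is not a breakpoint, so its instance there is recorded
  -- separately: g vanishes at M and every minimum is `b i`.
  AsymmetricHinges : ∀ {r} → Carrier → (Carrier → Carrier) → (Fin r → Carrier) → Set (c ⊔ ℓ₁ ⊔ ℓ₂)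
  AsymmetricHinges {r} M g b = ∃ λ k → ∃ λ (a : Fin r → Carrier) →
    (∀ i → 0# ≤ a i) × k * M ≈ ∑[ i < r ] (a i * b i) ×
    (∀ j → g (b j) + k * b j ≈ ∑[ i < r ] (a i * (b j ⊓ b i)))

  SymmetricHinges : ∀ {r} → (Carrier → Carrier) → (Fin r → Carrier) → Set (c ⊔ ℓ₁ ⊔ ℓ₂)
  SymmetricHinges {r} g b = ∃ λ (a : Fin r → Carrier) → (∀ i → 0# ≤ a i) ×
    (∀ j → g (b j) ≈ ∑[ i < r ] (a i * (b j ⊓ b i)))

  module _ {M} (0<M : 0# < M) (g : Carrier → Carrier) (g-cong : CongruentOn M g) (g-concave : ConcaveOn M g)
    (g0≈0 : g 0# ≈ 0#) where

    M∈ : M ∈[0, M ]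
    M∈ = proj₁ 0<M , ≤-refl

    g-above : ∀ {x y z} → x ∈[0, M ] → z ∈[0, M ] → x ≤ y → y < z → AboveChord g x y z
    g-above {x} {y} {z} x∈ z∈ x≤y y<z = concave⇒aboveChord g-cong g-concave x∈ z∈ x≤y (proj₁ y<z)
      (≤-trans x≤y (proj₁ y<z) , λ x≈z → proj₂ y<z (antisym (proj₁ y<z) (≤-respˡ-≈ x≈z x≤y)))

    -- Adding k x with k = g β / (M - β), β the largest breakpoint, makes g
    -- equal at β and M, hence nondecreasing on [0 , β].
    hinges-asymmetric : g M ≈ 0# → ∀ {r} (b : Fin r → Carrier) →
      (∀ i → 0# < b i) → (∀ i → b i < M) → (∀ {i j} → i Fin.< j → b i < b j) →
      AsymmetricHinges M g b
    -- Without breakpoints k M has to be the empty sum, hence k = 0.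
    hinges-asymmetric gM≈0 {zero}  b _ _ _ = 0# , (λ ()) , (λ ()) , zeroˡ M , (λ ())
    hinges-asymmetric gM≈0 {suc r} b 0<b b<M b-inc =
      extend (interpolate₀ D f f-mono (λ Dx _ Dz x<y y<z → f-above (D⇒∈ Dx) (D⇒∈ Dz) (proj₁ x<y) y<z) b
        (≤-refl , proj₁ (0<b (fromℕ r))) (trans (+-cong g0≈0 (zeroʳ k)) (+-identityˡ 0#))
        (λ i → proj₁ (0<b i) , b≤β i) 0<b b-inc)
      where
      β k : Carrier
      β = b (fromℕ r)
      k = g β * (M - β) ⁻¹

      f : Carrier → Carrier
      f x = g x + k * x

      D : Carrier → Set ℓ₂
      D x = 0# ≤ x × x ≤ β

      D⇒∈ : ∀ {x} → D x → x ∈[0, M ]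
      D⇒∈ (0≤x , x≤β) = 0≤x , ≤-trans x≤β (proj₁ (b<M (fromℕ r)))

      b≤β : ∀ i → b i ≤ β
      b≤β i = increasing⇒≤ b-inc (Fin.≤fromℕ i)

      fβ≈kM : f β ≈ k * M
      fβ≈kM = begin-equality
        g β + k * β            ≈⟨ +-congʳ (x*[y*x⁻¹]≈y (g β) (x<y⇒0<y-x (b<M (fromℕ r)))) ⟨
        (M - β) * k + k * β    ≈⟨ solve 3 (λ M β k → (M :- β) :* k :+ k :* β := k :* M) refl M β k ⟩
        k * M                  ∎

      fβ≈fM : f β ≈ f M
      fβ≈fM = trans fβ≈kM (sym (trans (+-congʳ gM≈0) (+-identityˡ (k * M))))

      f-above : ∀ {x y z} → x ∈[0, M ] → z ∈[0, M ] → x ≤ y → y < z → AboveChord f x y z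
      f-above x∈ z∈ x≤y y<z = aboveChord-addLinear {g} k (g-above x∈ z∈ x≤y y<z)

      -- M lies strictly beyond `D`, so it can serve as right endpoint for every y in `D`, β
      -- included. Monotonicity on `D` then follows by comparing x and y against M.
      f≤fM : ∀ {y} → D y → f y ≤ f M
      f≤fM Dy = ≤-respʳ-≈ fβ≈fM (aboveChord⇒≤ {f}
        (f-above (D⇒∈ Dy) M∈ (proj₂ Dy) (b<M (fromℕ r))) (proj₂ Dy) (b<M (fromℕ r)) (≤-reflexive fβ≈fM))

      f-mono : ∀ {x y} → D x → D y → x < y → f x ≤ f y
      f-mono {x} {y} Dx Dy x<y = aboveChord⇒≤ {f}
        (f-above (D⇒∈ Dx) M∈ (proj₁ x<y) y<M) (proj₁ x<y) y<M (f≤fM Dy)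
        where
        y<M : y < M
        y<M = proj₂ (D⇒∈ Dy) , λ y≈M → proj₂ (b<M (fromℕ r))
          (antisym (proj₁ (b<M (fromℕ r))) (≤-respˡ-≈ y≈M (proj₂ Dy)))

      extend : SymmetricHinges f b → AsymmetricHinges M g b
      extend (c , 0≤c , eq) = k , c , 0≤c ,
        -- The expansion is read at β, where f already has its value at M and every minimum equals
        -- `b i`.
        trans (sym fβ≈kM) (trans (eq (fromℕ r)) (sum-cong-≋ λ i → *-congˡ {c i} (x≤y⇒y⊓x≈x (b≤β i)))) , eq

    hinges-symmetric : SymmetricOn M g → ∀ {r} (b : Fin r → Carrier) →
      (∀ i → 0# < b i) → (∀ i → b i + b i ≤ M) → (∀ {i j} → i Fin.< j → b i < b j) →
      SymmetricHinges g b
    hinges-symmetric g-sym {r} b 0<b b+b≤M b-inc =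
      interpolate₀ D g g-mono (λ Dx _ Dz x<y y<z → g-above (D⇒∈ Dx) (D⇒∈ Dz) (proj₁ x<y) y<z) b
        (≤-refl , ≤-respˡ-≈ (sym (+-identityˡ 0#)) (proj₁ 0<M)) g0≈0
        (λ i → proj₁ (0<b i) , b+b≤M i) 0<b b-inc
      where
      D : Carrier → Set ℓ₂
      D x = 0# ≤ x × x + x ≤ M

      D⇒∈ : ∀ {x} → D x → x ∈[0, M ]
      D⇒∈ (0≤x , x+x≤M) = 0≤x , ≤-trans (x≤x+y 0≤x) x+x≤M

      -- In the lower half y lies between x and its mirror image M - x. By symmetry the chord over
      -- these two points is horizontal at height g x, and g y lies on or above it.
      g-mono : ∀ {x y} → D x → D y → x < y → g x ≤ g y
      g-mono {x} {y} Dx Dy x<y = *-cancelˡ-≤ 0<z-x (begin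
        (z - x) * g x
          ≈⟨ solve 4 (λ x y z u → (z :- x) :* u := (z :- y) :* u :+ (y :- x) :* u) refl x y z (g x) ⟩
        (z - y) * g x + (y - x) * g x
          ≈⟨ +-congˡ (*-congˡ (g-sym (D⇒∈ Dx))) ⟩
        (z - y) * g x + (y - x) * g z
          ≤⟨ concave⇒aboveChord g-cong g-concave (D⇒∈ Dx) z∈ (proj₁ x<y) y≤z x<z ⟩
        (z - x) * g y ∎)
        where
        z : Carrier
        z = M - x
        y≤z : y ≤ z
        y≤z = begin
          y            ≈⟨ solve 2 (λ x y → y := y :+ x :- x) refl x y ⟩
          y + x - x    ≤⟨ +-mono-≤ (+-monoʳ-≤ y (proj₁ x<y)) ≤-refl ⟩
          y + y - x    ≤⟨ +-mono-≤ (proj₂ Dy) ≤-refl ⟩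
          M - x        ∎
        x<z : x < z
        x<z = ≤-trans (proj₁ x<y) y≤z , λ x≈z → proj₂ x<y (antisym (proj₁ x<y) (≤-respʳ-≈ (sym x≈z) y≤z))
        0<z-x : 0# < z - x
        0<z-x = x<y⇒0<y-x x<z
        z∈ : z ∈[0, M ]
        z∈ = x≤y⇒0≤y-x (proj₂ (D⇒∈ Dx)) , (begin
          M - x        ≤⟨ x≤x+y (proj₁ Dx) ⟩
          M - x + x    ≈⟨ solve 2 (λ M x → M :- x :+ x := M) refl M x ⟩
          M            ∎)

  0<x⇒0<x+x : ∀ {x} → 0# < x → 0# < x + x
  0<x⇒0<x+x (0≤x , 0≉x) = +-nonNegative 0≤x 0≤x ,
    λ 0≈x+x → 0≉x (antisym 0≤x (≤-respʳ-≈ (sym 0≈x+x) (x≤x+y 0≤x)))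

  half+half : ∀ x → x * (1# + 1#) ⁻¹ + x * (1# + 1#) ⁻¹ ≈ x
  half+half x = begin-equality
    x * h + x * h        ≈⟨ +-cong (*-identityˡ _) (*-identityˡ _) ⟨
    1# * (x * h) + 1# * (x * h)
      ≈⟨ solve 3 (λ o x h → o :* (x :* h) :+ o :* (x :* h) := (o :+ o) :* (x :* h)) refl 1# x h ⟩
    (1# + 1#) * (x * h)  ≈⟨ x*[y*x⁻¹]≈y x (0<x⇒0<x+x (0≤1 , 0≉1)) ⟩
    x                    ∎
    where
    h : Carrier
    h = (1# + 1#) ⁻¹

  x+x≤y+y⇒x≤y : ∀ {x y} → x + x ≤ y + y → x ≤ y
  x+x≤y+y⇒x≤y {x} {y} x+x≤y+y = *-cancelˡ-≤ (0<x⇒0<x+x (0≤1 , 0≉1)) (begin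
    (1# + 1#) * x  ≈⟨ twice x ⟩
    x + x          ≤⟨ x+x≤y+y ⟩
    y + y          ≈⟨ twice y ⟨
    (1# + 1#) * y  ∎)
    where
    twice : ∀ x → (1# + 1#) * x ≈ x + x
    twice x = trans (solve 2 (λ o x → (o :+ o) :* x := o :* x :+ o :* x) refl 1# x)
      (+-cong (*-identityˡ x) (*-identityˡ x))

  -- Decompositions of `w` and the gadgets that realise them

  module Reduction {n} (γ : Fin n → Carrier) (0<γ : ∀ v → 0# < γ v) (0<M : 0# < ⟦ γ ⟧ ⊤)
    (g : Carrier → Carrier) (g-cong : CongruentOn (⟦ γ ⟧ ⊤) g) (g-concave : ConcaveOn (⟦ γ ⟧ ⊤) g)
    (g0≈0 : g 0# ≈ 0#) (gM≈0 : g (⟦ γ ⟧ ⊤) ≈ 0#)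
    where
    open SubsetSums γ 0<γ

    w : Subset n → Carrier
    w S = g (⟦ γ ⟧ S)

    enumerate-Qₐ : ∃ λ r → ∃ λ (b : Fin r → Carrier) → IncreasinglyEnumerates (Qₐ γ) b
    enumerate-Qₐ = enumerate (λ S → nonempty? S ×-dec (S ⊂? ⊤)) ⟦ γ ⟧
      (λ S (S-nonempty , S⊂⊤) → S , S-nonempty , S⊂⊤ , refl)
      (λ (S , S-nonempty , S⊂⊤ , x≈) → S , (S-nonempty , S⊂⊤) , x≈)

    AsymmetricDecomposition : ∀ {r} → (Fin r → Carrier) → Set (c ⊔ ℓ₁ ⊔ ℓ₂)
    AsymmetricDecomposition {r} b = ∃ λ (a : Fin r → Carrier) → (∀ i → 0# ≤ a i) ×
      (∀ S → w S ≈ ∑[ i < r ] (a i * (((M - b i) * ⟦ γ ⟧ S) ⊓ (b i * ⟦ γ ⟧ (∁ S)))))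

    hinges⇒asymmetricDecomposition : ∀ {r} {b : Fin r → Carrier} → IncreasinglyEnumerates (Qₐ γ) b →
      AsymmetricHinges M g b → AsymmetricDecomposition b
    hinges⇒asymmetricDecomposition {r} {b} b-enumerates (k , c , 0≤c , kM≈ , at-b) =
      a , (λ i → *-nonNegative (0≤c i) (⁻¹-nonNegative 0<M)) , w≈
      where
      open IncreasinglyEnumerates b-enumerates

      a : Fin r → Carrier
      a i = c i * M ⁻¹

      module _ (S : Subset n) where
        x : Carrier
        x = ⟦ γ ⟧ S

        tent : Fin r → Carrier
        tent i = ((M - b i) * x) ⊓ (b i * ⟦ γ ⟧ (∁ S))

        hinged : g x + k * x ≈ ∑[ i < r ] (c i * (x ⊓ b i))
        hinged with trivial⊎Qₐ S
        ... | inj₁ x≈0 = begin-equality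
          g x + k * x
            ≈⟨ +-cong (trans (g-cong (⟦γ⟧∈ S) (≤-refl , proj₁ 0<M) x≈0) g0≈0) (trans (*-congˡ x≈0) (zeroʳ k)) ⟩
          0# + 0#
            ≈⟨ +-identityˡ 0# ⟩
          0#
            ≈⟨ sum-*-0 c b x≈0 (proj₁ ∘ Qₐ⇒0< ∘ sound) ⟨
          ∑[ i < r ] (c i * (x ⊓ b i)) ∎
        ... | inj₂ (inj₁ x≈M) = begin-equality
          g x + k * x
            ≈⟨ +-cong (trans (g-cong (⟦γ⟧∈ S) (proj₁ 0<M , ≤-refl) x≈M) gM≈0) (trans (*-congˡ x≈M) kM≈) ⟩
          0# + ∑[ i < r ] (c i * b i)
            ≈⟨ +-identityˡ _ ⟩
          ∑[ i < r ] (c i * b i)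
            ≈⟨ sum-cong-≋ (λ i → *-congˡ {c i} (x≤y⇒y⊓x≈x (≤-respʳ-≈ (sym x≈M) (proj₁ (Qₐ⇒<M (sound i)))))) ⟨
          ∑[ i < r ] (c i * (x ⊓ b i)) ∎
        ... | inj₂ (inj₂ x∈Qₐ) with j , x≈bj ← complete x∈Qₐ = begin-equality
          g x + k * x
            ≈⟨ +-cong (g-cong (⟦γ⟧∈ S) (proj₁ (Qₐ⇒0< (sound j)) , proj₁ (Qₐ⇒<M (sound j))) x≈bj) (*-congˡ x≈bj) ⟩
          g (b j) + k * b j
            ≈⟨ at-b j ⟩
          ∑[ i < r ] (c i * (b j ⊓ b i))
            ≈⟨ sum-cong-≋ (λ i → *-congˡ {c i} (⊓-congʳ (b i) x≈bj)) ⟨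
          ∑[ i < r ] (c i * (x ⊓ b i)) ∎

        -- The second summand is the share of hinge i in the correction k x: by `kM≈` these shares
        -- add up to x / M times k M, and so cancel it.
        tent≈hinge : ∀ i → a i * tent i + x * M ⁻¹ * (c i * b i) ≈ c i * (x ⊓ b i)
        tent≈hinge i = begin-equality
          c i * M ⁻¹ * tent i + x * M ⁻¹ * (c i * b i)
            ≈⟨ solve 5 (λ c m t x b → c :* m :* t :+ x :* m :* (c :* b) := c :* (m :* (t :+ b :* x)))
                 refl (c i) (M ⁻¹) (tent i) x (b i) ⟩
          c i * (M ⁻¹ * (tent i + b i * x))
            ≈⟨ *-congˡ (*-congˡ (*-⊓-tent (proj₁ 0<M) (⟦γ⟧-∁ S))) ⟨
          c i * (M ⁻¹ * (M * (x ⊓ b i)))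
            ≈⟨ *-congˡ (x⁻¹*[x*y]≈y (x ⊓ b i) 0<M) ⟩
          c i * (x ⊓ b i) ∎

        w≈ : g x ≈ ∑[ i < r ] (a i * tent i)
        w≈ = begin-equality
          g x
            ≈⟨ solve 2 (λ u v → u := u :+ v :- v) refl (g x) (k * x) ⟩
          g x + k * x - k * x
            ≈⟨ +-congʳ hinged ⟩
          ∑[ i < r ] (c i * (x ⊓ b i)) - k * x
            ≈⟨ +-congʳ (sum-cong-≋ tent≈hinge) ⟨
          ∑[ i < r ] (a i * tent i + x * M ⁻¹ * (c i * b i)) - k * x
            ≈⟨ +-congʳ (∑-distrib-+ (λ i → a i * tent i) (λ i → x * M ⁻¹ * (c i * b i))) ⟩
          ∑[ i < r ] (a i * tent i) + ∑[ i < r ] (x * M ⁻¹ * (c i * b i)) - k * x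
            ≈⟨ +-congʳ (+-congˡ (*-distribˡ-sum (x * M ⁻¹) (λ i → c i * b i))) ⟨
          ∑[ i < r ] (a i * tent i) + x * M ⁻¹ * ∑[ i < r ] (c i * b i) - k * x
            ≈⟨ +-congʳ (+-congˡ (*-congˡ kM≈)) ⟨
          ∑[ i < r ] (a i * tent i) + x * M ⁻¹ * (k * M) - k * x
            ≈⟨ +-congʳ (+-congˡ (solve 4 (λ x m k M → x :* m :* (k :* M) := m :* (M :* (k :* x))) refl x (M ⁻¹) k M)) ⟩
          ∑[ i < r ] (a i * tent i) + M ⁻¹ * (M * (k * x)) - k * x
            ≈⟨ +-congʳ (+-congˡ (x⁻¹*[x*y]≈y (k * x) 0<M)) ⟩
          ∑[ i < r ] (a i * tent i) + k * x - k * x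
            ≈⟨ solve 2 (λ u v → u :+ v :- v := u) refl _ (k * x) ⟩
          ∑[ i < r ] (a i * tent i) ∎

    enumerate-Qₛ : ∃ λ r → ∃ λ (b : Fin r → Carrier) → IncreasinglyEnumerates (Qₛ γ) b
    enumerate-Qₛ = enumerate
      (λ S → ((0# ≤? ⟦ γ ⟧ S) ×-dec ¬? (0# ≟ ⟦ γ ⟧ S)) ×-dec (⟦ γ ⟧ S ≤? M * (1# + 1#) ⁻¹)) ⟦ γ ⟧
      (λ S (0<γS , γS≤M/2) → S , 0<γS , γS≤M/2 , refl)
      (λ (S , 0<γS , γS≤M/2 , x≈) → S , (0<γS , γS≤M/2) , x≈)

    Qₛ⇒0< : ∀ {x} → Qₛ γ x → 0# < x
    Qₛ⇒0< (S , (0≤γS , 0≉γS) , _ , x≈) = ≤-respʳ-≈ (sym x≈) 0≤γS , λ 0≈x → 0≉γS (trans 0≈x x≈)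

    Qₛ⇒x+x≤M : ∀ {x} → Qₛ γ x → x + x ≤ M
    Qₛ⇒x+x≤M {x} (S , _ , γS≤M/2 , x≈) = begin
      x + x                                      ≈⟨ +-cong x≈ x≈ ⟩
      ⟦ γ ⟧ S + ⟦ γ ⟧ S                            ≤⟨ +-mono-≤ γS≤M/2 γS≤M/2 ⟩
      M * (1# + 1#) ⁻¹ + M * (1# + 1#) ⁻¹        ≈⟨ half+half M ⟩
      M                                          ∎

    SymmetricDecomposition : ∀ {r} → (Fin r → Carrier) → Set (c ⊔ ℓ₁ ⊔ ℓ₂)
    SymmetricDecomposition {r} b = ∃ λ (a : Fin r → Carrier) → (∀ i → 0# ≤ a i) ×
      (∀ S → w S ≈ ∑[ i < r ] (a i * (⟦ γ ⟧ S ⊓ ⟦ γ ⟧ (∁ S) ⊓ b i)))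

    hinges⇒symmetricDecomposition : SymmetricOn M g →
      ∀ {r} {b : Fin r → Carrier} → IncreasinglyEnumerates (Qₛ γ) b →
      SymmetricHinges g b → SymmetricDecomposition b
    hinges⇒symmetricDecomposition g-sym {r} {b} b-enumerates (a , 0≤a , at-b) = a , 0≤a , w≈
      where
      open IncreasinglyEnumerates b-enumerates

      at-breakpoint : ∀ S → ∃[ j ] ⟦ γ ⟧ S ≈ b j → w S ≈ ∑[ i < r ] (a i * (⟦ γ ⟧ S ⊓ b i))
      at-breakpoint S (j , x≈bj) = begin-equality
        w S
          ≈⟨ g-cong (⟦γ⟧∈ S) (≤-respʳ-≈ x≈bj (proj₁ (⟦γ⟧∈ S)) , ≤-respˡ-≈ x≈bj (proj₂ (⟦γ⟧∈ S))) x≈bj ⟩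
        g (b j)
          ≈⟨ at-b j ⟩
        ∑[ i < r ] (a i * (b j ⊓ b i))
          ≈⟨ sum-cong-≋ (λ i → *-congˡ {a i} (⊓-congʳ (b i) x≈bj)) ⟨
        ∑[ i < r ] (a i * (⟦ γ ⟧ S ⊓ b i)) ∎

      -- A weight of at most M / 2 is either 0, where all hinges vanish, or an element of `Qₛ` and
      -- thus a breakpoint.
      small : ∀ S → ⟦ γ ⟧ S + ⟦ γ ⟧ S ≤ M → w S ≈ ∑[ i < r ] (a i * (⟦ γ ⟧ S ⊓ b i))
      small S x+x≤M with 0# ≟ ⟦ γ ⟧ S
      ... | yes 0≈x = trans (trans (g-cong (⟦γ⟧∈ S) (≤-refl , proj₁ 0<M) (sym 0≈x)) g0≈0)
        (sym (sum-*-0 a b (sym 0≈x) (λ i → proj₁ (Qₛ⇒0< (sound i)))))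
      ... | no 0≉x = at-breakpoint S (complete (S , (0≤⟦γ⟧ S , 0≉x) ,
        x+x≤y+y⇒x≤y (≤-respʳ-≈ (sym (half+half M)) x+x≤M) , refl))

      w-∁ : ∀ S → w S ≈ w (∁ S)
      w-∁ S = trans (g-sym (⟦γ⟧∈ S)) (g-cong
        (≤-respʳ-≈ (sym M-x≈y) (proj₁ (⟦γ⟧∈ (∁ S))) , ≤-respˡ-≈ (sym M-x≈y) (proj₂ (⟦γ⟧∈ (∁ S))))
        (⟦γ⟧∈ (∁ S)) M-x≈y)
        where
        M-x≈y : M - ⟦ γ ⟧ S ≈ ⟦ γ ⟧ (∁ S)
        M-x≈y = trans (+-congʳ (sym (⟦γ⟧-∁ S)))
          (solve 2 (λ x y → x :+ y :- x := y) refl (⟦ γ ⟧ S) (⟦ γ ⟧ (∁ S)))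

      -- The lighter of S and its complement weighs at most M / 2, and by `w-∁` both have the same
      -- value of `w`.
      w≈ : ∀ S → w S ≈ ∑[ i < r ] (a i * (⟦ γ ⟧ S ⊓ ⟦ γ ⟧ (∁ S) ⊓ b i))
      w≈ S = [ S-lighter , ∁S-lighter ]′ (total (⟦ γ ⟧ S) (⟦ γ ⟧ (∁ S)))
        where
        S-lighter : ⟦ γ ⟧ S ≤ ⟦ γ ⟧ (∁ S) → w S ≈ ∑[ i < r ] (a i * (⟦ γ ⟧ S ⊓ ⟦ γ ⟧ (∁ S) ⊓ b i))
        S-lighter x≤y = trans
          (small S (≤-respʳ-≈ (⟦γ⟧-∁ S) (+-monoʳ-≤ (⟦ γ ⟧ S) x≤y)))
          (sum-cong-≋ λ i → *-congˡ {a i} (⊓-congʳ (b i) (sym (x≤y⇒x⊓y≈x x≤y))))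
        ∁S-lighter : ⟦ γ ⟧ (∁ S) ≤ ⟦ γ ⟧ S → w S ≈ ∑[ i < r ] (a i * (⟦ γ ⟧ S ⊓ ⟦ γ ⟧ (∁ S) ⊓ b i))
        ∁S-lighter y≤x = trans (w-∁ S) (trans
          (small (∁ S) (≤-respʳ-≈ (⟦γ⟧-∁ S) (+-mono-≤ y≤x ≤-refl)))
          (sum-cong-≋ λ i → *-congˡ {a i} (⊓-congʳ (b i) (sym (x≤y⇒y⊓x≈x y≤x)))))

    AsymmetricReduction : Set (c ⊔ ℓ₁ ⊔ ℓ₂)
    AsymmetricReduction = GraphReducible w
      × ∃ λ r → ∃ λ (b : Fin r → Carrier) → IncreasinglyEnumerates (Qₐ γ) b
        × (∃ λ (a : Fin r → Carrier) →
            let gadget = λ i → asymmetricGadget γ (a i * (M - b i)) (a i * b i) in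
            (∀ i → 0# ≤ a i)
          × (∀ S → w S ≈ ∑[ i < r ] (a i * (((M - b i) * ⟦ γ ⟧ S) ⊓ (b i * ⟦ γ ⟧ (∁ S)))))
          × IsGadgetSplittingFunction (⋃ (map gadget (allFin r))) w
          × IsGadgetSplittingFunction (⋃ (map gadget (filter (λ i → ¬? (a i ≟ 0#)) (allFin r)))) w)
        × (∃ λ (Gs : List (Gadget n)) →
            length Gs ℕ.≤ r × All (IsAsymmetricGadget γ) Gs × IsGadgetSplittingFunction (⋃ Gs) w)

    asymmetricDecomposition⇒reduction : ∀ {r} {b : Fin r → Carrier} → IncreasinglyEnumerates (Qₐ γ) b →
      AsymmetricDecomposition b → AsymmetricReduction
    asymmetricDecomposition⇒reduction {r} {b} b-enumerates (a , 0≤a , w≈)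
      = (⋃ (map gadget (allFin r)) , nonNegative-⋃ (All.map⁺ (All.universal nonNegative (allFin r))) , splits)
      , r , b , b-enumerates
      , (a , 0≤a , w≈ , splits , splits-nonzero)
      , map gadget (allFin r) , length-map-allFin gadget
      , All.map⁺ (All.universal (λ i → a i * (M - b i) , a i * b i , 0≤out i , 0≤in i , ≡.refl) (allFin r))
      , splits
      where
      open IncreasinglyEnumerates b-enumerates

      gadget : Fin r → Gadget n
      gadget i = asymmetricGadget γ (a i * (M - b i)) (a i * b i)

      term : Fin r → Subset n → Carrier
      term i S = a i * (((M - b i) * ⟦ γ ⟧ S) ⊓ (b i * ⟦ γ ⟧ (∁ S)))

      0≤out : ∀ i → 0# ≤ a i * (M - b i)
      0≤out i = *-nonNegative (0≤a i) (x≤y⇒0≤y-x (proj₁ (Qₐ⇒<M (sound i))))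

      0≤in : ∀ i → 0# ≤ a i * b i
      0≤in i = *-nonNegative (0≤a i) (proj₁ (Qₐ⇒0< (sound i)))

      nonNegative : ∀ i → NonNegativeWeights (gadget i)
      nonNegative i = nonNegative-asymmetric (proj₁ ∘ 0<γ) (0≤out i) (0≤in i)

      gadget-splits : ∀ i → IsGadgetSplittingFunction (gadget i) (term i)
      gadget-splits i = splitting-cong {G = gadget i}
        -- The coefficient `a i`, being nonnegative, passes through the minimum and is absorbed into
        -- the two gadget parameters.
        (λ S → trans (⊓-cong (*-assoc _ _ _) (*-assoc _ _ _)) (sym (*-distribˡ-⊓ (0≤a i) _ _)))
        (splitting-asymmetric γ (a i * (M - b i)) (a i * b i))

      splits : IsGadgetSplittingFunction (⋃ (map gadget (allFin r))) w
      splits = splitting-cong {G = ⋃ (map gadget (allFin r))}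
        (λ S → trans (sumˡ-allFin (λ i → term i S)) (sym (w≈ S)))
        (splitting-⋃ gadget-splits (allFin r))

      nonzero? : Decidable (λ i → ¬ a i ≈ 0#)
      nonzero? i = ¬? (a i ≟ 0#)

      splits-nonzero : IsGadgetSplittingFunction (⋃ (map gadget (filter nonzero? (allFin r)))) w
      splits-nonzero = splitting-cong {G = ⋃ (map gadget (filter nonzero? (allFin r)))}
        (λ S → trans
          (sumˡ-filter nonzero?
            (λ i ¬a≉0 → trans (*-congʳ (decidable-stable (a i ≟ 0#) ¬a≉0)) (zeroˡ _)) (allFin r))
          (trans (sumˡ-allFin (λ i → term i S)) (sym (w≈ S))))
        (splitting-⋃ gadget-splits (filter nonzero? (allFin r)))

    asymmetric-reduction : AsymmetricReduction
    asymmetric-reduction = reduce enumerate-Qₐ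
      where
      reduce : (∃ λ r → ∃ λ (b : Fin r → Carrier) → IncreasinglyEnumerates (Qₐ γ) b) → AsymmetricReduction
      reduce (_ , b , b-enumerates) = asymmetricDecomposition⇒reduction b-enumerates
        (hinges⇒asymmetricDecomposition b-enumerates
          (hinges-asymmetric 0<M g g-cong g-concave g0≈0 gM≈0 b
            (λ i → Qₐ⇒0< (sound i)) (λ i → Qₐ⇒<M (sound i)) increasing))
        where open IncreasinglyEnumerates b-enumerates

    SymmetricReduction : Set (c ⊔ ℓ₁ ⊔ ℓ₂)
    SymmetricReduction =
      ∃ λ r → ∃ λ (b : Fin r → Carrier) → IncreasinglyEnumerates (Qₛ γ) b
      × (∃ λ (a : Fin r → Carrier) →
          let gadget = λ i → scale (a i) (symmetricGadget γ (b i)) in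
          (∀ i → 0# ≤ a i)
        × (∀ S → w S ≈ ∑[ i < r ] (a i * (⟦ γ ⟧ S ⊓ ⟦ γ ⟧ (∁ S) ⊓ b i)))
        × IsGadgetSplittingFunction (⋃ (map gadget (allFin r))) w)
      × (∃ λ (Gs : List (Gadget n)) →
          length Gs ℕ.≤ r × All (IsScaledSymmetricGadget γ) Gs × IsGadgetSplittingFunction (⋃ Gs) w)

    symmetricDecomposition⇒reduction : ∀ {r} {b : Fin r → Carrier} → IncreasinglyEnumerates (Qₛ γ) b →
      SymmetricDecomposition b → SymmetricReduction
    symmetricDecomposition⇒reduction {r} {b} b-enumerates (a , 0≤a , w≈)
      = r , b , b-enumerates
      , (a , 0≤a , w≈ , splits)
      , map gadget (allFin r) , length-map-allFin gadget
      , All.map⁺ (All.universal (λ i → a i , b i , 0≤a i , Qₛ⇒0< (sound i) , ≡.refl) (allFin r))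
      , splits
      where
      open IncreasinglyEnumerates b-enumerates

      gadget : Fin r → Gadget n
      gadget i = scale (a i) (symmetricGadget γ (b i))

      splits : IsGadgetSplittingFunction (⋃ (map gadget (allFin r))) w
      splits = splitting-cong {G = ⋃ (map gadget (allFin r))}
        (λ S → trans (sumˡ-allFin (λ i → a i * (⟦ γ ⟧ S ⊓ ⟦ γ ⟧ (∁ S) ⊓ b i))) (sym (w≈ S)))
        (splitting-⋃ (λ i → splitting-symmetric γ (b i) (0≤a i) 0≤⟦γ⟧) (allFin r))

    symmetric-reduction : SymmetricOn M g → SymmetricReduction
    symmetric-reduction g-sym = reduce enumerate-Qₛ
      where
      reduce : (∃ λ r → ∃ λ (b : Fin r → Carrier) → IncreasinglyEnumerates (Qₛ γ) b) → SymmetricReduction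
      reduce (_ , b , b-enumerates) = symmetricDecomposition⇒reduction b-enumerates
        (hinges⇒symmetricDecomposition g-sym b-enumerates
          (hinges-symmetric 0<M g g-cong g-concave g0≈0 g-sym b
            (λ i → Qₛ⇒0< (sound i)) (λ i → Qₛ⇒x+x≤M (sound i)) increasing))
        where open IncreasinglyEnumerates b-enumerates

theorem3 : ∀ {c ℓ₁ ℓ₂} (K : OrderedField c ℓ₁ ℓ₂) →
  let open OrderedField K
      open EDVW K
  in
  ∀ {n} → 2 ℕ.≤ n →
  (γ : Fin n → Carrier) → (∀ v → 0# < γ v) →
  let M = ⟦ γ ⟧ ⊤ in
  (g : Carrier → Carrier) →
  CongruentOn M g → NonNegativeOn M g → ConcaveOn M g →
  g 0# ≈ 0# → g M ≈ 0# →
  let w : Subset n → Carrier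
      w S = g (⟦ γ ⟧ S)
  in
  -- (i)
  ( GraphReducible w
  × ∃ λ r → ∃ λ (b : Fin r → Carrier) → IncreasinglyEnumerates (Qₐ γ) b
    × (∃ λ (a : Fin r → Carrier) →
        let gadget = λ i → asymmetricGadget γ (a i * (M - b i)) (a i * b i) in
        (∀ i → 0# ≤ a i)
      × (∀ S → w S ≈ ∑[ i < r ] (a i * (((M - b i) * ⟦ γ ⟧ S) ⊓ (b i * ⟦ γ ⟧ (∁ S)))))
      × IsGadgetSplittingFunction (⋃ (map gadget (allFin r))) w
      × IsGadgetSplittingFunction (⋃ (map gadget (filter (λ i → ¬? (a i ≟ 0#)) (allFin r)))) w)
    × (∃ λ (Gs : List (Gadget n)) →
        length Gs ℕ.≤ r × All (IsAsymmetricGadget γ) Gs × IsGadgetSplittingFunction (⋃ Gs) w))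
  ×
  -- (ii)
  ( SymmetricOn M g →
    ∃ λ r → ∃ λ (b : Fin r → Carrier) → IncreasinglyEnumerates (Qₛ γ) b
    × (∃ λ (a : Fin r → Carrier) →
        let gadget = λ i → scale (a i) (symmetricGadget γ (b i)) in
        (∀ i → 0# ≤ a i)
      × (∀ S → w S ≈ ∑[ i < r ] (a i * (⟦ γ ⟧ S ⊓ ⟦ γ ⟧ (∁ S) ⊓ b i)))
      × IsGadgetSplittingFunction (⋃ (map gadget (allFin r))) w)
    × (∃ λ (Gs : List (Gadget n)) →
        length Gs ℕ.≤ r × All (IsScaledSymmetricGadget γ) Gs × IsGadgetSplittingFunction (⋃ Gs) w))
theorem3 K (ℕ.s≤s _) γ 0<γ g g-cong _ g-concave g0≈0 gM≈0 =
    EDVWProperties.Reduction.asymmetric-reduction K γ 0<γ 0<M g g-cong g-concave g0≈0 gM≈0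
  , EDVWProperties.Reduction.symmetric-reduction K γ 0<γ 0<M g g-cong g-concave g0≈0 gM≈0
  where
  -- Matching on `2 ≤ n` has made n a successor, so `zero` is a vertex and e is nonempty.
  0<M = EDVWProperties.SubsetSums.0<⟦γ⟧ K γ 0<γ (zero , ∈⊤)
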